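{- (1) $\mathcal{K}^{\mathsf{TJ}}(\overline{K_n})=\{k:k\ge2\}$ for $n\ge2$. (2) $\mathcal{K}^{\mathsf{TJ}}(\overline{K_{1,n}})=\{k:k\ge2\}$ for $n\ge1$. (3) $\mathcal{K}^{\mathsf{TJ}}(\overline{K_{m,n}})=\{k:k\ge2\}$ for $2\le m\le n$. (4) $\mathcal{K}^{\mathsf{TJ}}(\overline{B_p})=\{k:k\ge2\}$ for $p\ge1$. (5) $\mathcal{K}^{\mathsf{TJ}}(\overline{P_n})=\{k:k\ge2\}$ for $3\le n\le5$, and $=\varnothing$ for $n\ge6$. (6) $\mathcal{K}^{\mathsf{TJ}}(\overline{C_n})=\{k:k\ge2\}$ for $4\le n\le6$, and $=\varnothing$ for $n\ge7$. (7) $\mathcal{K}^{\mathsf{TJ}}(\overline{F_p})=\{k:k\ge2\}$ for $p\in\{1,2\}$, $\mathcal{K}^{\mathsf{TJ}}(\overline{F_3})=\{2\}$, and $\mathcal{K}^{\mathsf{TJ}}(\overline{F_p})=\varnothing$ for $p\ge4$.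
   Context: All graphs are finite, simple, undirected; $\overline{G}$ denotes the complement of $G$. A $k$-clique of a graph $H$ is a set of $k$ pairwise adjacent vertices. For a graph $H$ and integer $k\ge1$, the Token Jumping graph $\mathsf{TJ}_k(H)$ has as vertices the $k$-cliques of $H$, and two $k$-cliques $A,B$ are adjacent iff $|A\cap B|=k-1$. For a graph $G$, $\mathcal{K}^{\mathsf{TJ}}(G)=\{k\ge1:\ \exists H,\ \mathsf{TJ}_k(H)\cong G\}$. $K_n$, $P_n$, $C_n$ denote the complete graph, path, cycle on $n$ vertices; $K_{m,n}$ the complete bipartite graph. The book graph $B_p$ consists of $p$ triangles sharing a common edge; the friendship graph $F_p$ consists of $p$ triangles sharing a common vertex. -}

module Defs where

open import Data.Bool.Properties using () renaming (_≟_ to _≟ᵇ_)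
open import Data.Empty using (⊥; ⊥-elim-irr)
open import Data.Fin using (Fin; toℕ)
open import Data.Fin.Properties using () renaming (_≟_ to _≟ᶠ_)
open import Data.Fin.Subset using (Subset; _∈_; _∩_; ∣_∣)
open import Data.Fin.Subset.Properties using (∩-comm; ∩-idem)
open import Data.Nat using (ℕ; suc; _≤_) renaming (_≟_ to _≟ⁿ_)
open import Data.Nat.Properties using (1+n≢n)
open import Data.Product using (Σ-syntax; ∃-syntax; _×_; _,_)
open import Data.Product.Properties using () renaming (≡-dec to ×-≡-dec)
open import Data.Sum using (_⊎_; inj₁; inj₂; swap)
open import Data.Sum.Properties using () renaming (≡-dec to ⊎-≡-dec)
open import Data.Unit using (⊤; tt)
open import Data.Unit.Properties using () renaming (_≟_ to _≟ᵗ_)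
open import Data.Vec.Properties using () renaming (≡-dec to Vec-≡-dec)
open import Function.Bundles using (_↔_; _⇔_; Inverse)
open import Level using (0ℓ) renaming (suc to lsuc)
open import Relation.Binary.Core using (Rel)
open import Relation.Binary.Definitions using (Decidable; DecidableEquality)
open import Relation.Binary.PropositionalEquality
  using (_≡_; _≢_; refl; sym; trans; cong; ≢-sym)
open import Relation.Nullary using (¬_; yes; no)
open import Relation.Nullary.Decidable using (¬?; _×-dec_; _⊎-dec_; map′)
open import Relation.Unary using (Pred)

-- Simple undirected graphs on the vertex set V.  Finiteness is a matter of V,
-- which is a concrete finite type for every graph below.  Decidability of
-- equality and adjacency is automatic, classically.
record Graph (V : Set) : Set₁ where
  infix 4 _~_ _~?_ _≟_
  field
    _~_     : Rel V 0ℓ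
    ~-sym   : ∀ {u v} → u ~ v → v ~ u
    ~-irr   : ∀ {v} → ¬ (v ~ v)
    _~?_    : Decidable _~_
    _≟_     : DecidableEquality V

infix 4 _≅_
record _≅_ {V W : Set} (G : Graph V) (H : Graph W) : Set where
  private
    module G = Graph G
    module H = Graph H
  field
    bijection : V ↔ W
    adjacency : ∀ u v → (u G.~ v) ⇔ (Inverse.to bijection u H.~ Inverse.to bijection v)

-- u and v are adjacent iff they are distinct and R relates them in some order.
fromRel : {V : Set} → DecidableEquality V → (R : Rel V 0ℓ) → Decidable R → Graph V
fromRel _≟_ R R? = record
  { _~_   = λ u v → u ≢ v × (R u v ⊎ R v u)
  ; ~-sym = λ (u≢v , r) → ≢-sym u≢v , swap r
  ; ~-irr = λ (v≢v , _) → v≢v refl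
  ; _~?_  = λ u v → ¬? (u ≟ v) ×-dec (R? u v ⊎-dec R? v u)
  ; _≟_   = _≟_
  }

complement : {V : Set} → Graph V → Graph V
complement G = record
  { _~_   = λ u v → u ≢ v × ¬ (u ~ v)
  ; ~-sym = λ (u≢v , u≁v) → ≢-sym u≢v , λ v~u → u≁v (~-sym v~u)
  ; ~-irr = λ (v≢v , _) → v≢v refl
  ; _~?_  = λ u v → ¬? (u ≟ v) ×-dec ¬? (u ~? v)
  ; _≟_   = _≟_
  }
  where open Graph G

completeGraph : (n : ℕ) → Graph (Fin n)
completeGraph n = fromRel _≟ᶠ_ (λ _ _ → ⊤) (λ _ _ → yes tt)

pathGraph : (n : ℕ) → Graph (Fin n)
pathGraph n = fromRel _≟ᶠ_ (λ i j → suc (toℕ i) ≡ toℕ j) (λ i j → suc (toℕ i) ≟ⁿ toℕ j)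

-- The cycle C_n when n ≥ 3: consecutive vertices are adjacent, and so are the
-- last vertex i = n - 1 and the first vertex j = 0.
cycleGraph : (n : ℕ) → Graph (Fin n)
cycleGraph n = fromRel _≟ᶠ_
  (λ i j → suc (toℕ i) ≡ toℕ j ⊎ (suc (toℕ i) ≡ n × toℕ j ≡ 0))
  (λ i j → (suc (toℕ i) ≟ⁿ toℕ j) ⊎-dec ((suc (toℕ i) ≟ⁿ n) ×-dec (toℕ j ≟ⁿ 0)))

completeBipartite : (m n : ℕ) → Graph (Fin m ⊎ Fin n)
completeBipartite m n = fromRel (⊎-≡-dec _≟ᶠ_ _≟ᶠ_) R R?
  where
  R : Rel (Fin m ⊎ Fin n) 0ℓ
  R (inj₁ _) (inj₂ _) = ⊤
  R _        _        = ⊥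

  R? : Decidable R
  R? (inj₁ _) (inj₂ _) = yes tt
  R? (inj₁ _) (inj₁ _) = no λ ()
  R? (inj₂ _) (inj₁ _) = no λ ()
  R? (inj₂ _) (inj₂ _) = no λ ()

-- Fin 2 holds the ends of the common edge, Fin p the third vertices of the
-- triangles; an end of the common edge is adjacent to every other vertex.
bookGraph : (p : ℕ) → Graph (Fin 2 ⊎ Fin p)
bookGraph p = fromRel (⊎-≡-dec _≟ᶠ_ _≟ᶠ_) R R?
  where
  R : Rel (Fin 2 ⊎ Fin p) 0ℓ
  R (inj₁ _) _ = ⊤
  R (inj₂ _) _ = ⊥

  R? : Decidable R
  R? (inj₁ _) _ = yes tt
  R? (inj₂ _) _ = no λ ()

-- inj₁ tt is the common vertex; inj₂ (i , 0) and inj₂ (i , 1) are the other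
-- two vertices of the i-th triangle.
friendshipGraph : (p : ℕ) → Graph (⊤ ⊎ (Fin p × Fin 2))
friendshipGraph p = fromRel (⊎-≡-dec _≟ᵗ_ (×-≡-dec _≟ᶠ_ _≟ᶠ_)) R R?
  where
  R : Rel (⊤ ⊎ (Fin p × Fin 2)) 0ℓ
  R (inj₁ _)       _              = ⊤
  R (inj₂ _)       (inj₁ _)       = ⊥
  R (inj₂ (i , _)) (inj₂ (j , _)) = i ≡ j

  R? : Decidable R
  R? (inj₁ _)       _              = yes tt
  R? (inj₂ _)       (inj₁ _)       = no λ ()
  R? (inj₂ (i , _)) (inj₂ (j , _)) = i ≟ᶠ j

-- The proofs are irrelevant, so that two cliques are equal as soon as their
-- vertex sets are.
record Clique {n : ℕ} (H : Graph (Fin n)) (k : ℕ) : Set where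
  constructor clique
  open Graph H using (_~_)
  field
    vertices  : Subset n
    .size     : ∣ vertices ∣ ≡ k
    .pairwise : ∀ {u v} → u ∈ vertices → v ∈ vertices → u ≢ v → u ~ v

-- |A ∩ B| = k - 1 is written 1 + |A ∩ B| = k, avoiding truncated subtraction.
TJ : {n : ℕ} (k : ℕ) (H : Graph (Fin n)) → Graph (Clique H k)
TJ k H = record
  { _~_   = λ A B → suc ∣ vertices A ∩ vertices B ∣ ≡ k
  ; ~-sym = λ {A} {B} → trans (cong (λ S → suc ∣ S ∣) (∩-comm (vertices B) (vertices A)))
  ; ~-irr = λ {A} → irr A
  ; _~?_  = λ A B → suc ∣ vertices A ∩ vertices B ∣ ≟ⁿ k
  ; _≟_   = λ A B → map′ ext (cong vertices) (Vec-≡-dec _≟ᵇ_ (vertices A) (vertices B))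
  }
  where
  open Clique

  irr : (A : Clique H k) → ¬ (suc ∣ vertices A ∩ vertices A ∣ ≡ k)
  irr (clique S size _) eq = absurd size
    where
    absurd : .(∣ S ∣ ≡ k) → ⊥
    absurd s with ∣ S ∣ ≟ⁿ k
    ... | yes s′ = 1+n≢n (trans (trans (cong (λ T → suc ∣ T ∣) (sym (∩-idem S))) eq) (sym s′))
    ... | no s≢k = ⊥-elim-irr (s≢k s)

  ext : {A B : Clique H k} → vertices A ≡ vertices B → A ≡ B
  ext refl = refl

-- Every finite graph is isomorphic to one on some Fin n, so it suffices to let
-- H range over the graphs on the types Fin n.
𝒦ᵀᴶ : {V : Set} → Graph V → Pred ℕ (lsuc 0ℓ)
𝒦ᵀᴶ G k = 1 ≤ k × (∃[ n ] Σ[ H ∈ Graph (Fin n) ] TJ k H ≅ G)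

{-# OPTIONS --safe #-}

-- TJ_k(H) is an induced subgraph of the Johnson graph of k-sets.
-- Existence: TJ_2(H) is the line graph of H.  If H is triangle-free, adding
-- universal vertices one at a time raises k without changing TJ_k, so it
-- suffices to present the graph as the line graph of a triangle-free graph.
-- Non-existence: for k = 1, TJ_k(H) is complete.  In a Johnson graph the common
-- neighbours of two non-adjacent vertices span a subgraph of the 4-cycle; the
-- complements of P_n (n ≥ 6) and C_n (n ≥ 7) contain such a pair with a path on
-- three vertices in the complement of the common neighbourhood, those of F_p
-- (p ≥ 4) one with a triangle in it.  For F_3 and k ≥ 3, take two triangles that
-- share an edge and have non-adjacent third vertices.  One of them has no common
-- (k - 1)-subset, so its union is a (k + 1)-clique of H, and removing a common
-- vertex of the three k-cliques from it gives a fourth vertex of TJ_k(H) adjacent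
-- to all three; but no K_4 exists.
module Submission where

open import Defs
open import Data.Bool using (Bool; true; false)
open import Data.Bool.Properties using () renaming (_≟_ to _≟ᵇ_)
open import Data.Empty using (⊥; ⊥-elim)
open import Data.Fin using (Fin; zero; suc; _↑ˡ_; _↑ʳ_; splitAt; join; inject₁)
open import Data.Fin.Patterns
open import Data.Fin.Properties using (any?; all?; splitAt-↑ˡ; splitAt-↑ʳ; splitAt-join; inject₁-injective) renaming (_≟_ to _≟ᶠ_)
open import Data.Fin.Subset using (Subset; _∈_; _∉_; _⊆_; _⊈_; _⊂_; _∩_; _∪_; _-_; ∣_∣; ⁅_⁆; Nonempty)
open import Data.Fin.Subset.Properties
open import Data.Nat using (ℕ; zero; suc; _+_; _≤_; _<_; z≤n; s≤s; _≟_)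
open import Data.Nat.Properties hiding (_≟_)
open import Data.Product using (∃; _×_; _,_; proj₁; proj₂)
open import Data.Sum using (_⊎_; inj₁; inj₂; [_,_]′)
open import Data.Unit using (⊤; tt)
open import Data.Vec using ([]; _∷_; here; there; _++_; lookup)
open import Data.Vec.Properties using (zipWith-++; ∷-injectiveʳ; ++-injective) renaming (≡-dec to Vec-≡-dec)
open import Function using (id)
open import Function.Bundles using (Inverse; Equivalence; mk↔ₛ′; mk⇔)
open import Level using (0ℓ)
open import Relation.Binary.PropositionalEquality using (_≡_; _≢_; refl; sym; trans; cong; cong₂; subst; subst₂; ≢-sym)
open import Relation.Nullary using (¬_; Dec; yes; no; contradiction)
open import Relation.Nullary.Decidable using (recompute; map′; ¬?; _×-dec_; _⊎-dec_; _→-dec_; decidable-stable; from-yes; from-no)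
open import Relation.Unary using (Decidable; Pred; _≐_; ∅; ｛_｝)

-- Cardinalities of finite subsets.

∣p∪q∣+∣p∩q∣≡∣p∣+∣q∣ : ∀ {n} (p q : Subset n) → ∣ p ∪ q ∣ + ∣ p ∩ q ∣ ≡ ∣ p ∣ + ∣ q ∣
∣p∪q∣+∣p∩q∣≡∣p∣+∣q∣ []          []          = refl
∣p∪q∣+∣p∩q∣≡∣p∣+∣q∣ (true ∷ p)  (true ∷ q)  =
  cong suc (trans (+-suc _ _) (trans (cong suc (∣p∪q∣+∣p∩q∣≡∣p∣+∣q∣ p q)) (sym (+-suc _ _))))
∣p∪q∣+∣p∩q∣≡∣p∣+∣q∣ (true ∷ p)  (false ∷ q) = cong suc (∣p∪q∣+∣p∩q∣≡∣p∣+∣q∣ p q)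
∣p∪q∣+∣p∩q∣≡∣p∣+∣q∣ (false ∷ p) (true ∷ q)  =
  trans (cong suc (∣p∪q∣+∣p∩q∣≡∣p∣+∣q∣ p q)) (sym (+-suc _ _))
∣p∪q∣+∣p∩q∣≡∣p∣+∣q∣ (false ∷ p) (false ∷ q) = ∣p∪q∣+∣p∩q∣≡∣p∣+∣q∣ p q

x∈p⇒suc∣p-x∣≡∣p∣ : ∀ {n} {p : Subset n} {x} → x ∈ p → suc ∣ p - x ∣ ≡ ∣ p ∣
x∈p⇒suc∣p-x∣≡∣p∣ {p = _ ∷ p} here = cong (λ q → suc ∣ q ∣) (p─⊥≡p p)
x∈p⇒suc∣p-x∣≡∣p∣ {p = true ∷ p}  (there x∈p) = cong suc (x∈p⇒suc∣p-x∣≡∣p∣ x∈p)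
x∈p⇒suc∣p-x∣≡∣p∣ {p = false ∷ p} (there x∈p) = x∈p⇒suc∣p-x∣≡∣p∣ x∈p

∣q∣≤∣p∣∧p⊆q⇒p≡q : ∀ {n} {p q : Subset n} → ∣ q ∣ ≤ ∣ p ∣ → p ⊆ q → p ≡ q
∣q∣≤∣p∣∧p⊆q⇒p≡q {p = p} {q} ∣q∣≤∣p∣ p⊆q = ⊆-antisym p⊆q q⊆p
  where
  q⊆p : q ⊆ p
  q⊆p {x} x∈q with x ∈? p
  ... | yes x∈p = x∈p
  ... | no  x∉p = contradiction ∣q∣≤∣p∣ (<⇒≱ (p⊂q⇒∣p∣<∣q∣ (p⊆q , x , x∈q , x∉p)))

⊈⇒∃ : ∀ {n} {p q : Subset n} → p ⊈ q → ∃ λ x → x ∈ p × x ∉ q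
⊈⇒∃ {p = []}        {[]}        p⊈q = contradiction (λ ()) p⊈q
⊈⇒∃ {p = true ∷ p}  {false ∷ q} p⊈q = zero , here , λ ()
⊈⇒∃ {p = true ∷ p}  {true ∷ q}  p⊈q =
  let x , x∈p , x∉q = ⊈⇒∃ (λ p⊆q → p⊈q (in⊆in p⊆q)) in suc x , there x∈p , λ { (there x∈q) → x∉q x∈q }
⊈⇒∃ {p = false ∷ p} {_ ∷ q}     p⊈q =
  let x , x∈p , x∉q = ⊈⇒∃ (λ p⊆q → p⊈q (out⊆ p⊆q)) in suc x , there x∈p , λ { (there x∈q) → x∉q x∈q }

∣p∣>0⇒Nonempty : ∀ {n} {p : Subset n} → 0 < ∣ p ∣ → Nonempty p
∣p∣>0⇒Nonempty {p = true ∷ p}  _     = zero , here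
∣p∣>0⇒Nonempty {p = false ∷ p} 0<∣p∣ = let x , x∈p = ∣p∣>0⇒Nonempty 0<∣p∣ in suc x , there x∈p

x∈p-y⇒x≢y : ∀ {n} {p : Subset n} {x y} → x ∈ p - y → x ≢ y
x∈p-y⇒x≢y {p = _ ∷ p} {zero}  {zero}  ()
x∈p-y⇒x≢y {p = _ ∷ p} {suc x} {suc .x} (there x∈) refl = x∈p-y⇒x≢y x∈ refl

-- Adjacency of `k`-sets in the Johnson graph.

module Johnson {n : ℕ} (k : ℕ) where

  infix 4 _∼_
  -- The sizes are bundled in, since `meet` alone does not make the two sets `k`-sets.
  record _∼_ (A B : Subset n) : Set where
    field
      sizeˡ : ∣ A ∣ ≡ k
      sizeʳ : ∣ B ∣ ≡ k
      meet  : suc ∣ A ∩ B ∣ ≡ k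
  open _∼_

  ∼-sym : ∀ {A B} → A ∼ B → B ∼ A
  ∼-sym {A} {B} A∼B = record
    { sizeˡ = sizeʳ A∼B
    ; sizeʳ = sizeˡ A∼B
    ; meet  = trans (cong (λ C → suc ∣ C ∣) (∩-comm B A)) (meet A∼B)
    }

  ∣∩∣<k : ∀ {A B : Subset n} → ∣ A ∣ ≡ k → ∣ B ∣ ≡ k → A ≢ B → ∣ A ∩ B ∣ < k
  ∣∩∣<k {A} {B} ∣A∣ ∣B∣ A≢B = ≰⇒> λ k≤ → A≢B (trans
    (sym (∣q∣≤∣p∣∧p⊆q⇒p≡q (≤-trans (≤-reflexive ∣A∣) k≤) (p∩q⊆p A B)))
    (∣q∣≤∣p∣∧p⊆q⇒p≡q (≤-trans (≤-reflexive ∣B∣) k≤) (p∩q⊆q A B)))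

  ≁⇒2+∣∩∣≤k : ∀ {A B} → ∣ A ∣ ≡ k → ∣ B ∣ ≡ k → A ≢ B → ¬ A ∼ B → 2 + ∣ A ∩ B ∣ ≤ k
  ≁⇒2+∣∩∣≤k ∣A∣ ∣B∣ A≢B A≁B = ≤∧≢⇒< (∣∩∣<k ∣A∣ ∣B∣ A≢B)
    λ meet → A≁B (record { sizeˡ = ∣A∣ ; sizeʳ = ∣B∣ ; meet = meet })

  ∼⇒∣∪∣≡1+k : ∀ {A B} → A ∼ B → ∣ A ∪ B ∣ ≡ suc k
  ∼⇒∣∪∣≡1+k {A} {B} A∼B = +-cancelʳ-≡ ∣ A ∩ B ∣ _ _ (trans (∣p∪q∣+∣p∩q∣≡∣p∣+∣q∣ A B)
    (trans (cong₂ _+_ (sizeˡ A∼B) (trans (sizeʳ A∼B) (sym (meet A∼B)))) (+-suc k _)))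

  -- By inclusion-exclusion the two sets share at least 2k - (k + 1) elements, and being distinct
  -- they share fewer than `k`.
  ∼-within : ∀ {A B C} → ∣ A ∣ ≡ k → ∣ B ∣ ≡ k → A ≢ B → ∣ C ∣ ≤ suc k → A ⊆ C → B ⊆ C → A ∼ B
  ∼-within {A} {B} {C} ∣A∣ ∣B∣ A≢B ∣C∣ A⊆C B⊆C = record
    { sizeˡ = ∣A∣
    ; sizeʳ = ∣B∣
    ; meet  = ≤-antisym (∣∩∣<k ∣A∣ ∣B∣ A≢B) (+-cancelˡ-≤ k _ _ (begin
        k + k                     ≡⟨ cong₂ _+_ ∣A∣ ∣B∣ ⟨
        ∣ A ∣ + ∣ B ∣             ≡⟨ ∣p∪q∣+∣p∩q∣≡∣p∣+∣q∣ A B ⟨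
        ∣ A ∪ B ∣ + ∣ A ∩ B ∣     ≤⟨ +-monoˡ-≤ _ (≤-trans (p⊆q⇒∣p∣≤∣q∣ A∪B⊆C) ∣C∣) ⟩
        suc k + ∣ A ∩ B ∣         ≡⟨ +-suc k _ ⟨
        k + suc ∣ A ∩ B ∣         ∎))
    }
    where
    open ≤-Reasoning
    A∪B⊆C : A ∪ B ⊆ C
    A∪B⊆C x∈ = [ A⊆C , B⊆C ]′ (x∈p∪q⁻ A B x∈)

  ∼-containing : ∀ {A B C D} → ∣ A ∣ ≡ k → ∣ B ∣ ≡ k → A ≢ B → C ∼ D → C ∩ D ⊆ A → C ∩ D ⊆ B → A ∼ B
  ∼-containing ∣A∣ ∣B∣ A≢B C∼D ⊆A ⊆B = record
    { sizeˡ = ∣A∣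
    ; sizeʳ = ∣B∣
    ; meet  = ≤-antisym (∣∩∣<k ∣A∣ ∣B∣ A≢B)
        (≤-trans (≤-reflexive (sym (meet C∼D))) (s≤s (p⊆q⇒∣p∣≤∣q∣ λ x∈ → x∈p∩q⁺ (⊆A x∈ , ⊆B x∈))))
    }

  -- Inclusion-exclusion for `A ∩ B` and `C ∩ B`, both of size k - 1, written without subtraction.
  -- Bounding one of the two summands controls the other.
  balance : ∀ {A B C} → A ∼ B → C ∼ B → 2 + (∣ (A ∪ C) ∩ B ∣ + ∣ (A ∩ C) ∩ B ∣) ≡ k + k
  balance {A} {B} {C} A∼B C∼B = trans (cong (2 +_) eq)
    (trans (cong suc (sym (+-suc _ _))) (cong₂ _+_ (meet A∼B) (meet C∼B)))
    where
    A∩C∩B≡ : (A ∩ C) ∩ B ≡ (A ∩ B) ∩ (C ∩ B)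
    A∩C∩B≡ = ⊆-antisym
      (λ x∈ → let x∈A∩C , x∈B = x∈p∩q⁻ (A ∩ C) B x∈ ; x∈A , x∈C = x∈p∩q⁻ A C x∈A∩C
              in x∈p∩q⁺ (x∈p∩q⁺ (x∈A , x∈B) , x∈p∩q⁺ (x∈C , x∈B)))
      (λ x∈ → let x∈A∩B , x∈C∩B = x∈p∩q⁻ (A ∩ B) (C ∩ B) x∈ ; x∈A , x∈B = x∈p∩q⁻ A B x∈A∩B
              in x∈p∩q⁺ (x∈p∩q⁺ (x∈A , proj₁ (x∈p∩q⁻ C B x∈C∩B)) , x∈B))
    eq : ∣ (A ∪ C) ∩ B ∣ + ∣ (A ∩ C) ∩ B ∣ ≡ ∣ A ∩ B ∣ + ∣ C ∩ B ∣
    eq = trans (cong₂ (λ p q → ∣ p ∣ + ∣ q ∣) (∩-distribʳ-∪ B A C) A∩C∩B≡)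
           (∣p∪q∣+∣p∩q∣≡∣p∣+∣q∣ (A ∩ B) (C ∩ B))

  -- Two (k - 1)-subsets of the `k`-set `B` overlap in at least k - 2 elements.
  k≤2+∣∩∩∣ : ∀ {A B C} → A ∼ B → C ∼ B → k ≤ 2 + ∣ (A ∩ C) ∩ B ∣
  k≤2+∣∩∩∣ {A} {B} {C} A∼B C∼B = +-cancelˡ-≤ k _ _ (begin
    k + k                                     ≡⟨ balance A∼B C∼B ⟨
    2 + (∣ (A ∪ C) ∩ B ∣ + ∣ (A ∩ C) ∩ B ∣)   ≡⟨ trans (+-suc _ _) (cong suc (+-suc _ _)) ⟨
    ∣ (A ∪ C) ∩ B ∣ + (2 + ∣ (A ∩ C) ∩ B ∣)   ≤⟨ +-monoˡ-≤ _ (∣p∩q∣≤∣q∣ (A ∪ C) B) ⟩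
    ∣ B ∣ + (2 + ∣ (A ∩ C) ∩ B ∣)             ≡⟨ cong (_+ _) (sizeʳ A∼B) ⟩
    k + (2 + ∣ (A ∩ C) ∩ B ∣)                 ∎)
    where open ≤-Reasoning

  -- If the two (k - 1)-subsets `A ∩ B` and `C ∩ B` overlap in no more than k - 2 elements, their
  -- union has `k` elements and so exhausts `B`.
  middle⊆∪ : ∀ {A B C} → A ∼ B → C ∼ B → 2 + ∣ (A ∩ C) ∩ B ∣ ≤ k → B ⊆ A ∪ C
  middle⊆∪ {A} {B} {C} A∼B C∼B small {x} x∈B = p∩q⊆p (A ∪ C) B (subst (x ∈_) (sym eq) x∈B)
    where
    open ≤-Reasoning
    eq : (A ∪ C) ∩ B ≡ B
    eq = ∣q∣≤∣p∣∧p⊆q⇒p≡q (+-cancelʳ-≤ k _ _ (begin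
      ∣ B ∣ + k                                     ≡⟨ cong (_+ k) (sizeʳ A∼B) ⟩
      k + k                                         ≡⟨ balance A∼B C∼B ⟨
      2 + (∣ (A ∪ C) ∩ B ∣ + ∣ (A ∩ C) ∩ B ∣)       ≡⟨ trans (+-suc _ _) (cong suc (+-suc _ _)) ⟨
      ∣ (A ∪ C) ∩ B ∣ + (2 + ∣ (A ∩ C) ∩ B ∣)       ≤⟨ +-monoʳ-≤ _ small ⟩
      ∣ (A ∪ C) ∩ B ∣ + k                           ∎)) (p∩q⊆q (A ∪ C) B)

  -- At least k - 2 elements of `A ∩ C` lie in `B`, and `A ∩ C` has no others.
  ∩⊆middle : ∀ {A B C} → A ∼ B → C ∼ B → 2 + ∣ A ∩ C ∣ ≤ k → A ∩ C ⊆ B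
  ∩⊆middle {A} {B} {C} A∼B C∼B small {x} x∈A∩C = p∩q⊆q (A ∩ C) B (subst (x ∈_) (sym eq) x∈A∩C)
    where
    eq : (A ∩ C) ∩ B ≡ A ∩ C
    eq = ∣q∣≤∣p∣∧p⊆q⇒p≡q (+-cancelˡ-≤ 2 _ _ (≤-trans small (k≤2+∣∩∩∣ A∼B C∼B))) (p∩q⊆p (A ∩ C) B)

  -- Distinct non-adjacent `k`-sets share at most k - 2 elements. Together with the next lemma this
  -- traps each of their common neighbours between their intersection and their union.
  ≁⇒∩⊆middle : ∀ {A B C} → A ≢ C → ¬ A ∼ C → A ∼ B → C ∼ B → A ∩ C ⊆ B
  ≁⇒∩⊆middle A≢C A≁C A∼B C∼B = ∩⊆middle A∼B C∼B (≁⇒2+∣∩∣≤k (sizeˡ A∼B) (sizeˡ C∼B) A≢C A≁C)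

  ≁⇒middle⊆∪ : ∀ {A B C} → A ≢ C → ¬ A ∼ C → A ∼ B → C ∼ B → B ⊆ A ∪ C
  ≁⇒middle⊆∪ {A} {B} {C} A≢C A≁C A∼B C∼B = middle⊆∪ A∼B C∼B
    (≤-trans (+-monoʳ-≤ 2 (∣p∩q∣≤∣p∣ (A ∩ C) B)) (≁⇒2+∣∩∣≤k (sizeˡ A∼B) (sizeˡ C∼B) A≢C A≁C))

  -- A triangle of the Johnson graph either has a common (k - 1)-subset or lies
  -- in a (k + 1)-set.
  triangle-⊆∪ : ∀ {A B C} → A ∼ B → A ∼ C → B ∼ C → B ∩ C ⊈ A → A ⊆ B ∪ C
  triangle-⊆∪ {A} {B} {C} A∼B A∼C B∼C B∩C⊈A =
    let x , x∈B∩C , x∉A = ⊈⇒∃ B∩C⊈A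
        ∩⊂∩ : (B ∩ C) ∩ A ⊂ B ∩ C
        ∩⊂∩ = p∩q⊆p (B ∩ C) A , x , x∈B∩C , λ x∈ → x∉A (p∩q⊆q (B ∩ C) A x∈)
    in middle⊆∪ (∼-sym A∼B) (∼-sym A∼C) (≤-trans (s≤s (p⊂q⇒∣p∣<∣q∣ ∩⊂∩)) (≤-reflexive (meet B∼C)))

  -- `A ∩ C` and `B ∩ C` have equal size, so an inclusion between them is an equality. Hence the
  -- absence of a common (k - 1)-subset can be stated at any vertex of the triangle.
  triangle-⊈ : ∀ {A B C} → A ∼ C → B ∼ C → B ∩ C ⊈ A → A ∩ C ⊈ B
  triangle-⊈ {A} {B} {C} A∼C B∼C B∩C⊈A A∩C⊆B = B∩C⊈A λ {x} x∈ → p∩q⊆p A C (subst (x ∈_) (sym eq) x∈)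
    where
    eq : A ∩ C ≡ B ∩ C
    eq = ∣q∣≤∣p∣∧p⊆q⇒p≡q (≤-reflexive (suc-injective (trans (meet B∼C) (sym (meet A∼C)))))
           (λ x∈ → x∈p∩q⁺ (A∩C⊆B x∈ , p∩q⊆q A C x∈))

  -- If `A` and `A′` both contained `B ∩ C`, or both lay in the (k + 1)-set `B ∪ C`, they would be
  -- adjacent. So the two triangles on the edge `B`, `C` are of opposite types.
  diamond : ∀ {A A′ B C} → A ≢ A′ → ¬ A ∼ A′ → A ∼ B → A ∼ C → A′ ∼ B → A′ ∼ C → B ∼ C →
    (B ∩ C ⊆ A × A′ ⊆ B ∪ C) ⊎ (B ∩ C ⊆ A′ × A ⊆ B ∪ C)
  diamond {A} {A′} {B} {C} A≢A′ A≁A′ A∼B A∼C A′∼B A′∼C B∼C with B ∩ C ⊆? A | B ∩ C ⊆? A′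
  ... | yes p | yes q = contradiction (∼-containing (sizeˡ A∼B) (sizeˡ A′∼B) A≢A′ B∼C p q) A≁A′
  ... | yes p | no ¬q = inj₁ (p , triangle-⊆∪ A′∼B A′∼C B∼C ¬q)
  ... | no ¬p | yes q = inj₂ (q , triangle-⊆∪ A∼B A∼C B∼C ¬p)
  ... | no ¬p | no ¬q = contradiction
    (∼-within (sizeˡ A∼B) (sizeˡ A′∼B) A≢A′ (≤-reflexive (∼⇒∣∪∣≡1+k B∼C))
      (triangle-⊆∪ A∼B A∼C B∼C ¬p) (triangle-⊆∪ A′∼B A′∼C B∼C ¬q)) A≁A′

  -- The common neighbours of two distinct non-adjacent k-sets induce a subgraph
  -- of the 4-cycle, which has no vertex with two non-neighbours and no triangle.
  no-two-non-neighbours : ∀ {A A′ B C D} →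
    A ≢ A′ → ¬ A ∼ A′ → B ≢ C → ¬ B ∼ C → C ≢ D → ¬ C ∼ D →
    A ∼ B → A ∼ C → A ∼ D → A′ ∼ B → A′ ∼ C → A′ ∼ D → B ≡ D
  no-two-non-neighbours {A} {A′} {B} {C} {D} A≢A′ A≁A′ B≢C B≁C C≢D C≁D A∼B A∼C A∼D A′∼B A′∼C A′∼D =
    ∣q∣≤∣p∣∧p⊆q⇒p≡q (≤-reflexive (trans (sizeʳ A∼D) (sym (sizeʳ A∼B)))) B⊆D
    where
    B∩C⊆ : ∀ {E} → E ∼ B → E ∼ C → B ∩ C ⊆ E
    B∩C⊆ E∼B E∼C = ≁⇒∩⊆middle B≢C B≁C (∼-sym E∼B) (∼-sym E∼C)
    ⊆C∪D : ∀ {E} → E ∼ C → E ∼ D → E ⊆ C ∪ D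
    ⊆C∪D E∼C E∼D = ≁⇒middle⊆∪ C≢D C≁D (∼-sym E∼C) (∼-sym E∼D)
    B⊆D : B ⊆ D
    B⊆D {x} x∈B with x ∈? C
    ... | yes x∈C = ≁⇒∩⊆middle A≢A′ A≁A′ A∼D A′∼D
      (x∈p∩q⁺ (B∩C⊆ A∼B A∼C x∈B∩C , B∩C⊆ A′∼B A′∼C x∈B∩C))
      where
      x∈B∩C : x ∈ B ∩ C
      x∈B∩C = x∈p∩q⁺ (x∈B , x∈C)
    -- Here `x` lies in `A ∪ A′` because `B` does, and both `A` and `A′` lie in `C ∪ D`.
    ... | no  x∉C = [ (λ x∈C → contradiction x∈C x∉C) , (λ x∈D → x∈D) ]′ (x∈p∪q⁻ C D
      ([ ⊆C∪D A∼C A∼D , ⊆C∪D A′∼C A′∼D ]′ (x∈p∪q⁻ A A′ (≁⇒middle⊆∪ A≢A′ A≁A′ A∼B A′∼B x∈B))))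

  -- `B ∩ C`, `C ∩ D` and `B ∩ D` all coincide with `A ∩ C`. Then `A′` lies in `(B ∪ C) ∩ (C ∪ D)`,
  -- which is `C ∪ (B ∩ D)` and thus `C`, although it has only k - 1 elements in common with `C`.
  two-stars : ∀ {A A′ B C D} → A′ ∼ C → A ∼ C → B ∼ C → C ∼ D → B ∼ D →
    B ∩ C ⊆ A → C ∩ D ⊆ A → A′ ⊆ B ∪ C → A′ ⊆ C ∪ D → ⊥
  two-stars {A} {A′} {B} {C} {D} A′∼C A∼C B∼C C∼D B∼D B∩C⊆A C∩D⊆A A′⊆B∪C A′⊆C∪D =
    1+n≢n (trans (meet A′∼C) (trans (sym (sizeˡ A′∼C)) (cong ∣_∣ A′≡A′∩C)))
    where
    B∩C≡A∩C : B ∩ C ≡ A ∩ C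
    B∩C≡A∩C = ∣q∣≤∣p∣∧p⊆q⇒p≡q (≤-reflexive (suc-injective (trans (meet A∼C) (sym (meet B∼C)))))
      (λ x∈ → x∈p∩q⁺ (B∩C⊆A x∈ , p∩q⊆q B C x∈))
    C∩D≡A∩C : C ∩ D ≡ A ∩ C
    C∩D≡A∩C = ∣q∣≤∣p∣∧p⊆q⇒p≡q (≤-reflexive (suc-injective (trans (meet A∼C) (sym (meet C∼D)))))
      (λ x∈ → x∈p∩q⁺ (C∩D⊆A x∈ , p∩q⊆p C D x∈))
    A∩C≡B∩D : A ∩ C ≡ B ∩ D
    A∩C≡B∩D = ∣q∣≤∣p∣∧p⊆q⇒p≡q (≤-reflexive (suc-injective (trans (meet B∼D) (sym (meet A∼C)))))
      (λ {x} x∈ → x∈p∩q⁺ ( p∩q⊆p B C (subst (x ∈_) (sym B∩C≡A∩C) x∈)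
                          , p∩q⊆q C D (subst (x ∈_) (sym C∩D≡A∩C) x∈)))
    A′⊆C : A′ ⊆ C
    A′⊆C {x} x∈A′ with x∈p∪q⁻ B C (A′⊆B∪C x∈A′) | x∈p∪q⁻ C D (A′⊆C∪D x∈A′)
    ... | inj₂ x∈C | _        = x∈C
    ... | inj₁ _   | inj₁ x∈C = x∈C
    ... | inj₁ x∈B | inj₂ x∈D = p∩q⊆q A C (subst (x ∈_) (sym A∩C≡B∩D) (x∈p∩q⁺ (x∈B , x∈D)))
    A′≡A′∩C : A′ ≡ A′ ∩ C
    A′≡A′∩C = ⊆-antisym (λ x∈ → x∈p∩q⁺ (x∈ , A′⊆C x∈)) (p∩q⊆p A′ C)

  -- By `diamond`, each edge of the triangle `B`, `C`, `D` has one of two types. Two of the three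
  -- edges agree in type and share a vertex, which `two-stars` excludes.
  no-triangle : ∀ {A A′ B C D} → A ≢ A′ → ¬ A ∼ A′ →
    A ∼ B → A ∼ C → A ∼ D → A′ ∼ B → A′ ∼ C → A′ ∼ D → B ∼ C → C ∼ D → D ∼ B → ⊥
  no-triangle A≢A′ A≁A′ A∼B A∼C A∼D A′∼B A′∼C A′∼D B∼C C∼D D∼B
    with diamond A≢A′ A≁A′ A∼B A∼C A′∼B A′∼C B∼C
       | diamond A≢A′ A≁A′ A∼C A∼D A′∼C A′∼D C∼D
       | diamond A≢A′ A≁A′ A∼D A∼B A′∼D A′∼B D∼B
  ... | inj₁ (p , q) | inj₁ (r , s) | _ = two-stars A′∼C A∼C B∼C C∼D (∼-sym D∼B) p r q s
  ... | inj₂ (p , q) | inj₂ (r , s) | _ = two-stars A∼C A′∼C B∼C C∼D (∼-sym D∼B) p r q s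
  ... | _ | inj₁ (p , q) | inj₁ (r , s) = two-stars A′∼D A∼D C∼D D∼B (∼-sym B∼C) p r q s
  ... | _ | inj₂ (p , q) | inj₂ (r , s) = two-stars A∼D A′∼D C∼D D∼B (∼-sym B∼C) p r q s
  ... | inj₁ (r , s) | _ | inj₁ (p , q) = two-stars A′∼B A∼B D∼B B∼C (∼-sym C∼D) p r q s
  ... | inj₂ (r , s) | _ | inj₂ (p , q) = two-stars A∼B A′∼B D∼B B∼C (∼-sym C∼D) p r q s

  -- If A ∪ B ∪ C has k + 1 elements, then each of A, B, C misses only one of them,
  -- so that any two elements lie together in A, B or C.
  fourth-set : ∀ {A B C} → 3 ≤ k → A ∼ B → A ∼ C → B ∼ C → B ∩ C ⊈ A →
    ∃ λ D → D ∼ A × D ∼ B × D ∼ C × (∀ {x y} → x ∈ D → y ∈ D →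
      (x ∈ A × y ∈ A) ⊎ (x ∈ B × y ∈ B) ⊎ (x ∈ C × y ∈ C))
  fourth-set {A} {B} {C} 3≤k A∼B A∼C B∼C B∩C⊈A = D ,
    D∼ A⊆M (sizeˡ A∼B) s∈A , D∼ (p⊆p∪q C) (sizeˡ B∼C) s∈B , D∼ (q⊆p∪q B C) (sizeʳ B∼C) s∈C ,
    λ x∈D y∈D → share (p─q⊆p M _ x∈D) (p─q⊆p M _ y∈D)
    where
    M = B ∪ C
    A⊆M : A ⊆ M
    A⊆M = triangle-⊆∪ A∼B A∼C B∼C B∩C⊈A
    B⊆A∪C : B ⊆ A ∪ C
    B⊆A∪C = triangle-⊆∪ (∼-sym A∼B) B∼C A∼C (triangle-⊈ A∼C B∼C B∩C⊈A)
    C⊆A∪B : C ⊆ A ∪ B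
    C⊆A∪B = triangle-⊆∪ (∼-sym A∼C) (∼-sym B∼C) A∼B
      (triangle-⊈ A∼B (∼-sym B∼C) (λ C∩B⊆A → B∩C⊈A (subst (_⊆ A) (∩-comm C B) C∩B⊆A)))

    -- This is where `3 ≤ k` enters: the triple intersection has at least k - 2 elements.
    common : Nonempty ((A ∩ C) ∩ B)
    common = ∣p∣>0⇒Nonempty (+-cancelˡ-≤ 2 _ _ (≤-trans 3≤k (k≤2+∣∩∩∣ A∼B (∼-sym B∼C))))
    s = proj₁ common
    s∈A∩C : s ∈ A ∩ C
    s∈A∩C = p∩q⊆p (A ∩ C) B (proj₂ common)
    s∈A : s ∈ A
    s∈A = p∩q⊆p A C s∈A∩C
    s∈B : s ∈ B
    s∈B = p∩q⊆q (A ∩ C) B (proj₂ common)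
    s∈C : s ∈ C
    s∈C = p∩q⊆q A C s∈A∩C

    D = M - s
    ∣D∣ : ∣ D ∣ ≡ k
    ∣D∣ = suc-injective (trans (x∈p⇒suc∣p-x∣≡∣p∣ (A⊆M s∈A)) (∼⇒∣∪∣≡1+k B∼C))

    D∼ : ∀ {E} → E ⊆ M → ∣ E ∣ ≡ k → s ∈ E → D ∼ E
    D∼ E⊆M ∣E∣ s∈E = ∼-within ∣D∣ ∣E∣ (λ D≡E → x∈p-y⇒x≢y (subst (s ∈_) (sym D≡E) s∈E) refl)
      (≤-reflexive (∼⇒∣∪∣≡1+k B∼C)) (p─q⊆p M _) E⊆M

    share : ∀ {x y} → x ∈ M → y ∈ M → (x ∈ A × y ∈ A) ⊎ (x ∈ B × y ∈ B) ⊎ (x ∈ C × y ∈ C)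
    share x∈M y∈M with x∈p∪q⁻ B C x∈M | x∈p∪q⁻ B C y∈M
    ... | inj₁ x∈B | inj₁ y∈B = inj₂ (inj₁ (x∈B , y∈B))
    ... | inj₂ x∈C | inj₂ y∈C = inj₂ (inj₂ (x∈C , y∈C))
    -- An element of one set lies in one of the other two, so unless `B` or `C` already holds both
    -- elements, `A` does.
    ... | inj₁ x∈B | inj₂ y∈C with x∈p∪q⁻ A C (B⊆A∪C x∈B) | x∈p∪q⁻ A B (C⊆A∪B y∈C)
    ...   | inj₂ x∈C | _        = inj₂ (inj₂ (x∈C , y∈C))
    ...   | inj₁ _   | inj₂ y∈B = inj₂ (inj₁ (x∈B , y∈B))
    ...   | inj₁ x∈A | inj₁ y∈A = inj₁ (x∈A , y∈A)
    share x∈M y∈M | inj₂ x∈C | inj₁ y∈B with x∈p∪q⁻ A B (C⊆A∪B x∈C) | x∈p∪q⁻ A C (B⊆A∪C y∈B)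
    ...   | inj₂ x∈B | _        = inj₂ (inj₁ (x∈B , y∈B))
    ...   | inj₁ _   | inj₂ y∈C = inj₂ (inj₂ (x∈C , y∈C))
    ...   | inj₁ x∈A | inj₁ y∈A = inj₁ (x∈A , y∈A)

-- Graphs realised by `k`-cliques.

private variable
  V : Set

PairwiseAdjacent : ∀ {n} → Graph (Fin n) → Subset n → Set
PairwiseAdjacent H S = ∀ {x y} → x ∈ S → y ∈ S → x ≢ y → Graph._~_ H x y

-- An isomorphism between `TJ k H` and `G`, unfolded into vertex sets so that no irrelevant proofs
-- are left in the data.
record Realisation (k : ℕ) {n : ℕ} (H : Graph (Fin n)) (G : Graph V) : Set where
  open Graph G using (_~_)
  open Johnson {n} k using (_∼_)
  field
    ⟦_⟧        : V → Subset n
    size       : ∀ v → ∣ ⟦ v ⟧ ∣ ≡ k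
    pairwise   : ∀ v → PairwiseAdjacent H ⟦ v ⟧
    injective  : ∀ {u v} → ⟦ u ⟧ ≡ ⟦ v ⟧ → u ≡ v
    adjacent   : ∀ {u v} → u ~ v → suc ∣ ⟦ u ⟧ ∩ ⟦ v ⟧ ∣ ≡ k
    adjacent⁻¹ : ∀ {u v} → suc ∣ ⟦ u ⟧ ∩ ⟦ v ⟧ ∣ ≡ k → u ~ v
    surjective : ∀ S → ∣ S ∣ ≡ k → PairwiseAdjacent H S → ∃ λ v → ⟦ v ⟧ ≡ S

  ~⇒∼ : ∀ {u v} → u ~ v → ⟦ u ⟧ ∼ ⟦ v ⟧
  ~⇒∼ {u} {v} u~v = record { sizeˡ = size u ; sizeʳ = size v ; meet = adjacent u~v }

  ≁⇒≁ : ∀ {u v} → ¬ u ~ v → ¬ ⟦ u ⟧ ∼ ⟦ v ⟧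
  ≁⇒≁ u≁v u∼v = u≁v (adjacent⁻¹ (Johnson._∼_.meet u∼v))

  ≢⇒≢ : ∀ {u v} → u ≢ v → ⟦ u ⟧ ≢ ⟦ v ⟧
  ≢⇒≢ u≢v eq = u≢v (injective eq)

module _ {k n : ℕ} {H : Graph (Fin n)} where
  open Clique using (vertices)

  -- The proofs stored in a clique are irrelevant; decidability of equality and of adjacency makes
  -- them usable again, here and in the next lemma.
  clique-size : (A : Clique H k) → ∣ vertices A ∣ ≡ k
  clique-size (clique S size _) = recompute (∣ S ∣ ≟ k) size

  clique-pairwise : (A : Clique H k) → PairwiseAdjacent H (vertices A)
  clique-pairwise (clique S _ pairwise) {x} {y} x∈S y∈S x≢y =
    recompute (Graph._~?_ H x y) (pairwise x∈S y∈S x≢y)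

  clique-≡ : {A B : Clique H k} → vertices A ≡ vertices B → A ≡ B
  clique-≡ refl = refl

  TJ≅⇒Realisation : {G : Graph V} → TJ k H ≅ G → Realisation k H G
  TJ≅⇒Realisation {G = G} iso = record
    { ⟦_⟧        = λ v → vertices (from v)
    ; size       = λ v → clique-size (from v)
    ; pairwise   = λ v → clique-pairwise (from v)
    ; injective  = λ {u} {v} eq → trans (sym (strictlyInverseˡ u)) (trans (cong to (clique-≡ eq)) (strictlyInverseˡ v))
    ; adjacent   = λ {u} {v} u~v → Equivalence.from (adjacency (from u) (from v))
                     (subst₂ (Graph._~_ G) (sym (strictlyInverseˡ u)) (sym (strictlyInverseˡ v)) u~v)
    ; adjacent⁻¹ = λ {u} {v} meet → subst₂ (Graph._~_ G) (strictlyInverseˡ u) (strictlyInverseˡ v)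
                     (Equivalence.to (adjacency (from u) (from v)) meet)
    ; surjective = λ S size pairwise → to (clique S size pairwise) , cong vertices (strictlyInverseʳ (clique S size pairwise))
    }
    where
    open _≅_ iso
    open Inverse bijection

  Realisation⇒TJ≅ : {G : Graph V} → Realisation k H G → TJ k H ≅ G
  Realisation⇒TJ≅ {V = V} {G = G} R = record
    { bijection = mk↔ₛ′ to from (λ v → injective (to-vertices (from v))) (λ A → clique-≡ (to-vertices A))
    ; adjacency = λ A B → mk⇔
        (λ meet → adjacent⁻¹ (subst₂ Meet (sym (to-vertices A)) (sym (to-vertices B)) meet))
        (λ A~B → subst₂ Meet (to-vertices A) (to-vertices B) (adjacent A~B))
    }
    where
    open Realisation R
    Meet : Subset n → Subset n → Set
    Meet S T = suc ∣ S ∩ T ∣ ≡ k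
    preimage : (A : Clique H k) → ∃ λ v → ⟦ v ⟧ ≡ vertices A
    preimage A = surjective (vertices A) (clique-size A) (clique-pairwise A)
    to : Clique H k → V
    to A = proj₁ (preimage A)
    from : V → Clique H k
    from v = clique ⟦ v ⟧ (size v) (pairwise v)
    to-vertices : ∀ A → ⟦ to A ⟧ ≡ vertices A
    to-vertices A = proj₂ (preimage A)

-- Cones: raising `k` by a universal vertex.

pick : ∀ {n m} {S : Subset n} → ∣ S ∣ ≡ suc m → ∃ λ x → x ∈ S × ∣ S - x ∣ ≡ m
pick {S = S} size =
  let x , x∈S = ∣p∣>0⇒Nonempty {p = S} (≤-trans (s≤s z≤n) (≤-reflexive (sym size)))
  in x , x∈S , suc-injective (trans (x∈p⇒suc∣p-x∣≡∣p∣ x∈S) size)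

CliqueFree : ∀ {n} → ℕ → Graph (Fin n) → Set
CliqueFree k H = ∀ S → ∣ S ∣ ≡ k → ¬ PairwiseAdjacent H S

cone : ∀ {n} → Graph (Fin n) → Graph (Fin (suc n))
cone {n} H = record
  { _~_   = Adj
  ; ~-sym = λ {u} {v} → Adj-sym u v
  ; ~-irr = λ {v} → Adj-irr v
  ; _~?_  = Adj?
  ; _≟_   = _≟ᶠ_
  }
  where
  open Graph H using (_~_; ~-sym; ~-irr; _~?_)
  Adj : Fin (suc n) → Fin (suc n) → Set
  Adj zero    zero    = ⊥
  Adj zero    (suc _) = ⊤
  Adj (suc _) zero    = ⊤
  Adj (suc x) (suc y) = x ~ y
  Adj-sym : ∀ u v → Adj u v → Adj v u
  Adj-sym zero    (suc _) _   = tt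
  Adj-sym (suc _) zero    _   = tt
  Adj-sym (suc _) (suc _) x~y = ~-sym x~y
  Adj-irr : ∀ v → ¬ Adj v v
  Adj-irr (suc _) x~x = ~-irr x~x
  Adj? : ∀ u v → Dec (Adj u v)
  Adj? zero    zero    = no λ ()
  Adj? zero    (suc _) = yes tt
  Adj? (suc _) zero    = yes tt
  Adj? (suc x) (suc y) = x ~? y

module _ {n : ℕ} {H : Graph (Fin n)} where

  pairwise-tail : ∀ {s S} → PairwiseAdjacent (cone H) (s ∷ S) → PairwiseAdjacent H S
  pairwise-tail pairwise x∈S y∈S x≢y = pairwise (there x∈S) (there y∈S) λ { refl → x≢y refl }

  cone-cliqueFree : ∀ {k} → CliqueFree k H → CliqueFree (suc k) (cone H)
  cone-cliqueFree free (true  ∷ S) size pairwise = free S (suc-injective size) (pairwise-tail pairwise)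
  -- A clique that avoids the apex is one vertex too large; dropping any vertex leaves a forbidden
  -- clique of `H`.
  cone-cliqueFree free (false ∷ S) size pairwise =
    let x , _ , size-x = pick {S = S} size
    in free (S - x) size-x (λ y∈ z∈ → pairwise-tail pairwise (p─q⊆p S _ y∈) (p─q⊆p S _ z∈))

  -- As `H` has no (k + 1)-clique, every (k + 1)-clique of the cone contains the apex. Adding the
  -- apex is thus a bijection on cliques, and it raises sizes and intersections by one.
  cone-realisation : ∀ {k} {G : Graph V} → CliqueFree (suc k) H → Realisation k H G → Realisation (suc k) (cone H) G
  cone-realisation {k = k} free R = record
    { ⟦_⟧        = λ v → true ∷ ⟦ v ⟧
    ; size       = λ v → cong suc (size v)
    ; pairwise   = cone-pairwise
    ; injective  = λ { eq → injective (∷-injectiveʳ eq) }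
    ; adjacent   = λ u~v → cong suc (adjacent u~v)
    ; adjacent⁻¹ = λ meet → adjacent⁻¹ (suc-injective meet)
    ; surjective = cone-surjective
    }
    where
    open Realisation R
    cone-pairwise : ∀ v → PairwiseAdjacent (cone H) (true ∷ ⟦ v ⟧)
    cone-pairwise v here       here       x≢x = contradiction refl x≢x
    cone-pairwise v here       (there _)  _   = tt
    cone-pairwise v (there _)  here       _   = tt
    cone-pairwise v (there x∈) (there y∈) x≢y = pairwise v x∈ y∈ λ { refl → x≢y refl }
    cone-surjective : ∀ S → ∣ S ∣ ≡ suc k → PairwiseAdjacent (cone H) S → ∃ λ v → true ∷ ⟦ v ⟧ ≡ S
    cone-surjective (true  ∷ S) size pw =
      let v , eq = surjective S (suc-injective size) (pairwise-tail pw) in v , cong (true ∷_) eq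
    cone-surjective (false ∷ S) size pw = ⊥-elim (free S size (pairwise-tail pw))

-- Clique-freeness is carried through the induction because every further cone relies on it.
iterated-cone : ∀ {n} {H : Graph (Fin n)} {G : Graph V} → Realisation 2 H G → CliqueFree 3 H →
  ∀ j → ∃ λ m → ∃ λ (H′ : Graph (Fin m)) → Realisation (2 + j) H′ G × CliqueFree (3 + j) H′
iterated-cone {n = n} {H} R free zero    = n , H , R , free
iterated-cone             R free (suc j) =
  let _ , H′ , R′ , free′ = iterated-cone R free j
  in _ , cone H′ , cone-realisation free′ R′ , cone-cliqueFree free′

𝒦-cone : ∀ {n} {H : Graph (Fin n)} {G : Graph V} → Realisation 2 H G → CliqueFree 3 H →
  ∀ {k} → 2 ≤ k → 𝒦ᵀᴶ G k
𝒦-cone R free (s≤s (s≤s {n = j} _)) =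
  let m , H′ , R′ , _ = iterated-cone R free j in s≤s z≤n , m , H′ , Realisation⇒TJ≅ R′

-- Exhaustive search over vertex types.

Searchable : Set → Set₁
Searchable V = {P : Pred V 0ℓ} → Decidable P → Dec (∃ P)

⊤-searchable : Searchable ⊤
⊤-searchable P? = map′ (tt ,_) proj₂ (P? tt)

⊎-searchable : {V W : Set} → Searchable V → Searchable W → Searchable (V ⊎ W)
⊎-searchable V-s W-s P? = map′
  [ (λ (v , p) → inj₁ v , p) , (λ (w , p) → inj₂ w , p) ]′
  (λ { (inj₁ v , p) → inj₁ (v , p) ; (inj₂ w , p) → inj₂ (w , p) })
  (V-s (λ v → P? (inj₁ v)) ⊎-dec W-s (λ w → P? (inj₂ w)))

×-searchable : {V W : Set} → Searchable V → Searchable W → Searchable (V × W)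
×-searchable V-s W-s P? = map′
  (λ (v , w , p) → (v , w) , p) (λ ((v , w) , p) → v , w , p)
  (V-s (λ v → W-s (λ w → P? (v , w))))

forall? : Searchable V → {P : Pred V 0ℓ} → Decidable P → Dec (∀ v → P v)
forall? search P? = map′
  (λ ∄¬P v → decidable-stable (P? v) (λ ¬p → ∄¬P (v , ¬p)))
  (λ ∀P (v , ¬p) → ¬p (∀P v))
  (¬? (search (λ v → ¬? (P? v))))

-- Line graphs and the case k = 2.

two-elements : ∀ {n m} {S : Subset n} → ∣ S ∣ ≡ 2 + m →
  ∃ λ x → ∃ λ y → x ∈ S × y ∈ S × x ≢ y × ∣ S - x - y ∣ ≡ m
two-elements {S = S} size =
  let x , x∈S , size-x = pick size
      y , y∈S-x , size-xy = pick size-x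
  in x , y , x∈S , p─q⊆p S _ y∈S-x , ≢-sym (x∈p-y⇒x≢y y∈S-x) , size-xy

three-elements : ∀ {n} {S : Subset n} → ∣ S ∣ ≡ 3 →
  ∃ λ x → ∃ λ y → ∃ λ z → x ∈ S × y ∈ S × z ∈ S × x ≢ y × y ≢ z × x ≢ z
three-elements {S = S} size =
  let x , y , x∈S , y∈S , x≢y , size-xy = two-elements size
      z , z∈ , _ = pick size-xy
      z∈S-x = p─q⊆p (S - x) _ z∈
  in x , y , z , x∈S , y∈S , p─q⊆p S _ z∈S-x , x≢y , ≢-sym (x∈p-y⇒x≢y z∈) , ≢-sym (x∈p-y⇒x≢y z∈S-x)

2≤∣p∣ : ∀ {n} {p : Subset n} {x y} → x ∈ p → y ∈ p → x ≢ y → 2 ≤ ∣ p ∣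
2≤∣p∣ {p = p} {x} {y} x∈p y∈p x≢y =
  ≤-trans (s≤s (≤-trans (s≤s z≤n) (x∈p⇒∣p-x∣<∣p∣ (x∈p∧x≢y⇒x∈p-y y∈p (≢-sym x≢y)))))
          (x∈p⇒∣p-x∣<∣p∣ x∈p)

pair-determined : ∀ {n} {S T : Subset n} {x y} → ∣ S ∣ ≡ 2 → ∣ T ∣ ≡ 2 →
  x ∈ S → y ∈ S → x ∈ T → y ∈ T → x ≢ y → S ≡ T
pair-determined {S = S} {T} ∣S∣ ∣T∣ x∈S y∈S x∈T y∈T x≢y = trans
  (sym (∣q∣≤∣p∣∧p⊆q⇒p≡q (≤-trans (≤-reflexive ∣S∣) 2≤∣S∩T∣) (p∩q⊆p S T)))
  (∣q∣≤∣p∣∧p⊆q⇒p≡q (≤-trans (≤-reflexive ∣T∣) 2≤∣S∩T∣) (p∩q⊆q S T))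
  where
  2≤∣S∩T∣ : 2 ≤ ∣ S ∩ T ∣
  2≤∣S∩T∣ = 2≤∣p∣ (x∈p∩q⁺ (x∈S , x∈T)) (x∈p∩q⁺ (y∈S , y∈T)) x≢y

module _ (search : Searchable V) {n : ℕ} (e : V → Subset n) where

  Together : Fin n → Fin n → Set
  Together x y = ∃ λ v → x ∈ e v × y ∈ e v

  -- When the sets `e v` have two elements, they are exactly the edges of this graph.
  edgeGraph : Graph (Fin n)
  edgeGraph = fromRel _≟ᶠ_ Together (λ x y → search (λ v → (x ∈? e v) ×-dec (y ∈? e v)))

  module _ (G : Graph V) where
    open Graph G using (_~_; _~?_) renaming (_≟_ to _≟ᵛ_)

    -- A single condition on pairs of vertices, so that concrete instances are settled by evaluating
    -- `isLineGraph?`.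
    IsLineGraph : Set
    IsLineGraph = ∀ u v → (u ~ v → suc ∣ e u ∩ e v ∣ ≡ 2) × (suc ∣ e u ∩ e v ∣ ≡ 2 → u ~ v) × (e u ≡ e v → u ≡ v)

    isLineGraph? : Dec IsLineGraph
    isLineGraph? = forall? search λ u → forall? search λ v →
      (u ~? v →-dec (suc ∣ e u ∩ e v ∣ ≟ 2)) ×-dec
      ((suc ∣ e u ∩ e v ∣ ≟ 2) →-dec u ~? v) ×-dec
      (Vec-≡-dec _≟ᵇ_ (e u) (e v) →-dec u ≟ᵛ v)

    -- A 2-clique of `edgeGraph` is a pair of vertices lying together in some `e v`, and its two
    -- elements determine that set.
    lineGraph-realisation : (∀ v → ∣ e v ∣ ≡ 2) → IsLineGraph → Realisation 2 edgeGraph G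
    lineGraph-realisation size line = record
      { ⟦_⟧        = e
      ; size       = size
      ; pairwise   = λ v x∈ y∈ x≢y → x≢y , inj₁ (v , x∈ , y∈)
      ; injective  = λ {u} {v} → proj₂ (proj₂ (line u v))
      ; adjacent   = λ {u} {v} → proj₁ (line u v)
      ; adjacent⁻¹ = λ {u} {v} → proj₁ (proj₂ (line u v))
      ; surjective = surjective
      }
      where
      surjective : ∀ S → ∣ S ∣ ≡ 2 → PairwiseAdjacent edgeGraph S → ∃ λ v → e v ≡ S
      surjective S ∣S∣ pairwise with two-elements {S = S} ∣S∣
      ... | x , y , x∈S , y∈S , x≢y , _ with pairwise x∈S y∈S x≢y
      ...   | _ , inj₁ (v , x∈ , y∈) = v , pair-determined (size v) ∣S∣ x∈ y∈ x∈S y∈S x≢y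
      ...   | _ , inj₂ (v , y∈ , x∈) = v , pair-determined (size v) ∣S∣ x∈ y∈ x∈S y∈S x≢y

module _ {n : ℕ} (H : Graph (Fin n)) where
  open Graph H using (_~_; _~?_)

  -- Stated for triples of vertices so that three nested searches decide it.
  TriangleFree : Set
  TriangleFree = ∀ x y z → ¬ (x ~ y × y ~ z × x ~ z)

  triangleFree? : Dec TriangleFree
  triangleFree? = all? λ x → all? λ y → all? λ z → ¬? (x ~? y ×-dec y ~? z ×-dec x ~? z)

  triangleFree⇒cliqueFree : TriangleFree → CliqueFree 3 H
  triangleFree⇒cliqueFree free S size pairwise =
    let x , y , z , x∈ , y∈ , z∈ , x≢y , y≢z , x≢z = three-elements {S = S} size
    in free x y z (pairwise x∈ y∈ x≢y , pairwise y∈ z∈ y≢z , pairwise x∈ z∈ x≢z)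

  -- Of three vertices, two receive the same one of the two colours.
  bipartite⇒triangleFree : (colour : Fin n → Bool) → (∀ {x y} → x ~ y → colour x ≢ colour y) → TriangleFree
  bipartite⇒triangleFree colour proper x y z (x~y , y~z , x~z)
    with colour x | colour y | colour z | proper x~y | proper y~z | proper x~z
  ... | false | false | _     | p | _ | _ = p refl
  ... | true  | true  | _     | p | _ | _ = p refl
  ... | _     | false | false | _ | p | _ = p refl
  ... | _     | true  | true  | _ | p | _ = p refl
  ... | false | true  | false | _ | _ | p = p refl
  ... | true  | false | true  | _ | _ | p = p refl

-- Rook placements and line graphs of bipartite graphs.

∣p++q∣ : ∀ {m n} (p : Subset m) (q : Subset n) → ∣ p ++ q ∣ ≡ ∣ p ∣ + ∣ q ∣
∣p++q∣ []          q = refl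
∣p++q∣ (true  ∷ p) q = cong suc (∣p++q∣ p q)
∣p++q∣ (false ∷ p) q = ∣p++q∣ p q

x∈p++q⁻ : ∀ {m n} (p : Subset m) {q : Subset n} {x} → x ∈ p ++ q →
  (∃ λ i → i ∈ p × x ≡ i ↑ˡ n) ⊎ (∃ λ j → j ∈ q × x ≡ m ↑ʳ j)
x∈p++q⁻ []      x∈         = inj₂ (_ , x∈ , refl)
x∈p++q⁻ (_ ∷ p) here       = inj₁ (zero , here , refl)
x∈p++q⁻ (_ ∷ p) (there x∈) with x∈p++q⁻ p x∈
... | inj₁ (i , i∈ , eq) = inj₁ (suc i , there i∈ , cong suc eq)
... | inj₂ (j , j∈ , eq) = inj₂ (j , j∈ , cong suc eq)

⁅⁆-injective : ∀ {n} {i j : Fin n} → ⁅ i ⁆ ≡ ⁅ j ⁆ → i ≡ j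
⁅⁆-injective {i = i} {j} eq = x∈⁅y⁆⇒x≡y j (subst (i ∈_) eq (x∈⁅x⁆ i))

i≡j⇒∣⁅i⁆∩⁅j⁆∣≡1 : ∀ {n} {i j : Fin n} → i ≡ j → ∣ ⁅ i ⁆ ∩ ⁅ j ⁆ ∣ ≡ 1
i≡j⇒∣⁅i⁆∩⁅j⁆∣≡1 {i = i} refl = trans (cong ∣_∣ (∩-idem ⁅ i ⁆)) (∣⁅x⁆∣≡1 i)

i≢j⇒∣⁅i⁆∩⁅j⁆∣≡0 : ∀ {n} {i j : Fin n} → i ≢ j → ∣ ⁅ i ⁆ ∩ ⁅ j ⁆ ∣ ≡ 0
i≢j⇒∣⁅i⁆∩⁅j⁆∣≡0 {n} {i} {j} i≢j = trans (cong ∣_∣ (Empty-unique λ (x , x∈) →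
  let x∈i , x∈j = x∈p∩q⁻ ⁅ i ⁆ ⁅ j ⁆ x∈ in i≢j (trans (sym (x∈⁅y⁆⇒x≡y i x∈i)) (x∈⁅y⁆⇒x≡y j x∈j)))) (∣⊥∣≡0 n)

-- Placing each vertex on a square of its own of an m × n chessboard so that
-- adjacency is a rook's move presents G as the line graph of a bipartite graph.
module _ {m n : ℕ} (search : Searchable V) (G : Graph V) (row : V → Fin m) (column : V → Fin n) where
  open Graph G using (_~_; ~-irr; _~?_) renaming (_≟_ to _≟ᵛ_)

  IsRookPlacement : Set
  IsRookPlacement = ∀ u v →
    (row u ≡ row v → column u ≡ column v → u ≡ v) ×
    (u ~ v → row u ≡ row v ⊎ column u ≡ column v) ×
    (u ≢ v → row u ≡ row v ⊎ column u ≡ column v → u ~ v)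

  isRookPlacement? : Dec IsRookPlacement
  isRookPlacement? = forall? search λ u → forall? search λ v →
    ((row u ≟ᶠ row v) →-dec (column u ≟ᶠ column v) →-dec (u ≟ᵛ v)) ×-dec
    (u ~? v →-dec ((row u ≟ᶠ row v) ⊎-dec (column u ≟ᶠ column v))) ×-dec
    (¬? (u ≟ᵛ v) →-dec ((row u ≟ᶠ row v) ⊎-dec (column u ≟ᶠ column v)) →-dec u ~? v)

  rook-𝒦 : IsRookPlacement → ∀ {k} → 2 ≤ k → 𝒦ᵀᴶ G k
  rook-𝒦 rook = 𝒦-cone (lineGraph-realisation search e G size line)
      (triangleFree⇒cliqueFree H (bipartite⇒triangleFree H colour proper))
    where
    e : V → Subset (m + n)
    -- The square of `v` becomes the edge that joins its row to its column.
    e v = ⁅ row v ⁆ ++ ⁅ column v ⁆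

    H : Graph (Fin (m + n))
    H = edgeGraph search e

    size : ∀ v → ∣ e v ∣ ≡ 2
    size v = trans (∣p++q∣ ⁅ row v ⁆ ⁅ column v ⁆) (cong₂ _+_ (∣⁅x⁆∣≡1 (row v)) (∣⁅x⁆∣≡1 (column v)))

    ∣e∩e∣ : ∀ u v → ∣ e u ∩ e v ∣ ≡ ∣ ⁅ row u ⁆ ∩ ⁅ row v ⁆ ∣ + ∣ ⁅ column u ⁆ ∩ ⁅ column v ⁆ ∣
    ∣e∩e∣ u v = trans (cong ∣_∣ (zipWith-++ _ ⁅ row u ⁆ ⁅ column u ⁆ ⁅ row v ⁆ ⁅ column v ⁆))
      (∣p++q∣ (⁅ row u ⁆ ∩ ⁅ row v ⁆) (⁅ column u ⁆ ∩ ⁅ column v ⁆))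

    line : IsLineGraph search e G
    -- Two edges share one end for each coordinate in which their squares agree.
    line u v with rook u v | row u ≟ᶠ row v | column u ≟ᶠ column v
    ... | unique , _ , _ | yes r | yes c =
      (λ u~v → ⊥-elim (~-irr (subst (u ~_) (sym (unique r c)) u~v))) ,
      (λ meet → contradiction (trans (cong suc (sym (trans (∣e∩e∣ u v)
        (cong₂ _+_ (i≡j⇒∣⁅i⁆∩⁅j⁆∣≡1 r) (i≡j⇒∣⁅i⁆∩⁅j⁆∣≡1 c))))) meet) λ ()) ,
      (λ _ → unique r c)
    ... | _ , _ , move | yes r | no c =
      (λ _ → cong suc (trans (∣e∩e∣ u v) (cong₂ _+_ (i≡j⇒∣⁅i⁆∩⁅j⁆∣≡1 r) (i≢j⇒∣⁅i⁆∩⁅j⁆∣≡0 c)))) ,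
      (λ _ → move (λ u≡v → c (cong column u≡v)) (inj₁ r)) ,
      (λ eq → contradiction (⁅⁆-injective (proj₂ (++-injective ⁅ row u ⁆ ⁅ row v ⁆ eq))) c)
    ... | _ , _ , move | no r | yes c =
      (λ _ → cong suc (trans (∣e∩e∣ u v) (cong₂ _+_ (i≢j⇒∣⁅i⁆∩⁅j⁆∣≡0 r) (i≡j⇒∣⁅i⁆∩⁅j⁆∣≡1 c)))) ,
      (λ _ → move (λ u≡v → r (cong row u≡v)) (inj₂ c)) ,
      (λ eq → contradiction (⁅⁆-injective (proj₁ (++-injective ⁅ row u ⁆ ⁅ row v ⁆ eq))) r)
    ... | _ , share , _ | no r | no c =
      (λ u~v → ⊥-elim ([ r , c ]′ (share u~v))) ,
      (λ meet → contradiction (trans (cong suc (sym (trans (∣e∩e∣ u v)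
        (cong₂ _+_ (i≢j⇒∣⁅i⁆∩⁅j⁆∣≡0 r) (i≢j⇒∣⁅i⁆∩⁅j⁆∣≡0 c))))) meet) λ ()) ,
      (λ eq → contradiction (⁅⁆-injective (proj₁ (++-injective ⁅ row u ⁆ ⁅ row v ⁆ eq))) r)

    side : Fin m ⊎ Fin n → Bool
    side (inj₁ _) = true
    side (inj₂ _) = false

    colour : Fin (m + n) → Bool
    colour x = side (splitAt m x)

    ends : ∀ v {x} → x ∈ e v → (x ≡ row v ↑ˡ n × colour x ≡ true) ⊎ (x ≡ m ↑ʳ column v × colour x ≡ false)
    ends v x∈ with x∈p++q⁻ ⁅ row v ⁆ x∈
    ... | inj₁ (i , i∈ , refl) = inj₁ (cong (_↑ˡ n) (x∈⁅y⁆⇒x≡y (row v) i∈) , cong side (splitAt-↑ˡ m i n))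
    ... | inj₂ (j , j∈ , refl) = inj₂ (cong (m ↑ʳ_) (x∈⁅y⁆⇒x≡y (column v) j∈) , cong side (splitAt-↑ʳ m n j))

    ends-differ : ∀ v {x y} → x ≢ y → x ∈ e v → y ∈ e v → colour x ≢ colour y
    ends-differ v x≢y x∈ y∈ eq with ends v x∈ | ends v y∈
    ... | inj₁ (p , _) | inj₁ (q , _) = x≢y (trans p (sym q))
    ... | inj₂ (p , _) | inj₂ (q , _) = x≢y (trans p (sym q))
    ... | inj₁ (_ , p) | inj₂ (_ , q) = contradiction (trans (sym p) (trans eq q)) λ ()
    ... | inj₂ (_ , p) | inj₁ (_ , q) = contradiction (trans (sym p) (trans eq q)) λ ()

    proper : ∀ {x y} → Graph._~_ H x y → colour x ≢ colour y
    proper (x≢y , inj₁ (v , x∈ , y∈)) = ends-differ v x≢y x∈ y∈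
    proper (x≢y , inj₂ (v , y∈ , x∈)) = ends-differ v x≢y x∈ y∈

-- For a disjoint union of complete graphs, each class gets a row and each vertex a column of its
-- own, so that all moves are along rows.
cluster-𝒦 : ∀ {m n} (search : Searchable V) (G : Graph V) (class : V → Fin m) (index : V → Fin n) →
  let open Graph G using (_~_) in
  (∀ {u v} → index u ≡ index v → u ≡ v) → (∀ u v → u ~ v → class u ≡ class v) →
  (∀ u v → u ≢ v → class u ≡ class v → u ~ v) → ∀ {k} → 2 ≤ k → 𝒦ᵀᴶ G k
cluster-𝒦 search G class index index-injective ⇒class class⇒ = rook-𝒦 search G class index λ u v →
  (λ _ → index-injective) , (λ u~v → inj₁ (⇒class u v u~v)) ,
  (λ u≢v → [ class⇒ u v u≢v , (λ eq → contradiction (index-injective eq) u≢v) ]′)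

join-injective : ∀ m n {u v : Fin m ⊎ Fin n} → join m n u ≡ join m n v → u ≡ v
join-injective m n {u} {v} eq =
  trans (sym (splitAt-join m n u)) (trans (cong (splitAt m) eq) (splitAt-join m n v))

-- Obstructions for realised graphs.

module _ {k n : ℕ} {H : Graph (Fin n)} {G : Graph V} (R : Realisation k H G) where
  open Graph G using (_~_)
  open Realisation R
  open Johnson {n} k

  realised-no-two-non-neighbours : ∀ {a a′ b c d} → a ≢ a′ → ¬ a ~ a′ → b ≢ c → ¬ b ~ c → c ≢ d → ¬ c ~ d →
    a ~ b → a ~ c → a ~ d → a′ ~ b → a′ ~ c → a′ ~ d → b ≡ d
  realised-no-two-non-neighbours a≢a′ a≁a′ b≢c b≁c c≢d c≁d a~b a~c a~d a′~b a′~c a′~d =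
    injective (no-two-non-neighbours (≢⇒≢ a≢a′) (≁⇒≁ a≁a′) (≢⇒≢ b≢c) (≁⇒≁ b≁c) (≢⇒≢ c≢d) (≁⇒≁ c≁d)
      (~⇒∼ a~b) (~⇒∼ a~c) (~⇒∼ a~d) (~⇒∼ a′~b) (~⇒∼ a′~c) (~⇒∼ a′~d))

  realised-no-triangle : ∀ {a a′ b c d} → a ≢ a′ → ¬ a ~ a′ →
    a ~ b → a ~ c → a ~ d → a′ ~ b → a′ ~ c → a′ ~ d → b ~ c → c ~ d → d ~ b → ⊥
  realised-no-triangle a≢a′ a≁a′ a~b a~c a~d a′~b a′~c a′~d b~c c~d d~b =
    no-triangle (≢⇒≢ a≢a′) (≁⇒≁ a≁a′)
      (~⇒∼ a~b) (~⇒∼ a~c) (~⇒∼ a~d) (~⇒∼ a′~b) (~⇒∼ a′~c) (~⇒∼ a′~d) (~⇒∼ b~c) (~⇒∼ c~d) (~⇒∼ d~b)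

  -- Any two elements of the set from `fourth-set` lie in one of three cliques of `H`. So it is a
  -- clique itself, and represents a vertex.
  realised-K₄ : 3 ≤ k → ∀ {a b c} → a ~ b → a ~ c → b ~ c → ⟦ b ⟧ ∩ ⟦ c ⟧ ⊈ ⟦ a ⟧ →
    ∃ λ d → d ~ a × d ~ b × d ~ c
  realised-K₄ 3≤k {a} {b} {c} a~b a~c b~c b∩c⊈a
    with fourth-set 3≤k (~⇒∼ a~b) (~⇒∼ a~c) (~⇒∼ b~c) b∩c⊈a
  ... | D , D∼a , D∼b , D∼c , share with surjective D (_∼_.sizeˡ D∼a) (λ x∈D y∈D x≢y →
          [ (λ (x∈ , y∈) → pairwise a x∈ y∈ x≢y) ,
          [ (λ (x∈ , y∈) → pairwise b x∈ y∈ x≢y) ,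
            (λ (x∈ , y∈) → pairwise c x∈ y∈ x≢y) ]′ ]′ (share x∈D y∈D))
  ...   | d , refl = d , adjacent⁻¹ (_∼_.meet D∼a) , adjacent⁻¹ (_∼_.meet D∼b) , adjacent⁻¹ (_∼_.meet D∼c)

  -- Only one of `a` and `a′` can contain the intersection of `b` and `c`, as otherwise they would
  -- be adjacent; the other one feeds `realised-K₄`.
  realised-diamond : 3 ≤ k → ∀ {a a′ b c} → a ≢ a′ → ¬ a ~ a′ →
    a ~ b → a ~ c → a′ ~ b → a′ ~ c → b ~ c → ∃ λ d → (d ~ a ⊎ d ~ a′) × d ~ b × d ~ c
  realised-diamond 3≤k {a} {a′} {b} {c} a≢a′ a≁a′ a~b a~c a′~b a′~c b~c
    with ⟦ b ⟧ ∩ ⟦ c ⟧ ⊆? ⟦ a ⟧ | ⟦ b ⟧ ∩ ⟦ c ⟧ ⊆? ⟦ a′ ⟧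
  ... | yes p | yes q = contradiction (∼-containing (size a) (size a′) (≢⇒≢ a≢a′) (~⇒∼ b~c) p q) (≁⇒≁ a≁a′)
  ... | no ¬p | _     = let d , d~a , d~bc = realised-K₄ 3≤k a~b a~c b~c ¬p in d , inj₁ d~a , d~bc
  ... | yes _ | no ¬q = let d , d~a′ , d~bc = realised-K₄ 3≤k a′~b a′~c b~c ¬q in d , inj₂ d~a′ , d~bc

-- Distinct 1-sets meet in 0 = k - 1 elements, so for k = 1 any two distinct vertices are adjacent.
𝒦⇒2≤ : (G : Graph V) {u v : V} → u ≢ v → ¬ Graph._~_ G u v → ∀ {k} → 𝒦ᵀᴶ G k → 2 ≤ k
𝒦⇒2≤ G u≢v u≁v {zero}        (() , _)
𝒦⇒2≤ G u≢v u≁v {suc (suc k)} _ = s≤s (s≤s z≤n)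
𝒦⇒2≤ G {u} {v} u≢v u≁v {suc zero} (_ , _ , H , iso) = contradiction
  (adjacent⁻¹ (cong suc (n<1⇒n≡0 (Johnson.∣∩∣<k 1 (size u) (size v) (≢⇒≢ u≢v))))) u≁v
  where open Realisation (TJ≅⇒Realisation iso)

≐2≤ : {V : Set} (G : Graph V) {u v : V} → u ≢ v → ¬ Graph._~_ G u v →
  (∀ {k} → 2 ≤ k → 𝒦ᵀᴶ G k) → 𝒦ᵀᴶ G ≐ (2 ≤_)
≐2≤ G u≢v u≁v realise = 𝒦⇒2≤ G u≢v u≁v , realise

≐∅ : {V : Set} (G : Graph V) → (∀ {k n} {H : Graph (Fin n)} → ¬ Realisation k H G) → 𝒦ᵀᴶ G ≐ ∅
≐∅ G none = (λ (_ , _ , _ , iso) → none (TJ≅⇒Realisation iso)) , λ ()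

-- Complements of complete, complete bipartite and book graphs.

complement-K : ∀ n → 2 ≤ n → 𝒦ᵀᴶ (complement (completeGraph n)) ≐ (2 ≤_)
complement-K n@(suc (suc _)) _ = ≐2≤ (complement (completeGraph n)) {0F} {1F} (λ ())
  (λ (u≢v , u≁v) → u≁v (u≢v , inj₁ tt))
  -- The complement has no edges: every vertex is a class of its own.
  (cluster-𝒦 any? (complement (completeGraph n)) id id id
    (λ u v (u≢v , u≁v) → contradiction (u≢v , inj₁ tt) u≁v)
    (λ u v u≢v u≡v → contradiction u≡v u≢v))
complement-K 1 (s≤s ())

-- The complement consists of two disjoint complete graphs, one for each side. Stars are the case
-- `m` = 1.
complement-K[_,_] : ∀ m n → 1 ≤ m → 1 ≤ n → 𝒦ᵀᴶ (complement (completeBipartite m n)) ≐ (2 ≤_)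
complement-K[ m@(suc _) , n@(suc _) ] _ _ = ≐2≤ G {inj₁ 0F} {inj₂ 0F} (λ ())
  (λ (u≢v , u≁v) → u≁v (u≢v , inj₁ tt))
  (cluster-𝒦 (⊎-searchable any? any?) G part (join m n) (join-injective m n) ⇒part part⇒)
  where
  G : Graph (Fin m ⊎ Fin n)
  G = complement (completeBipartite m n)
  open Graph G using (_~_)
  part : Fin m ⊎ Fin n → Fin 2
  part = [ (λ _ → 0F) , (λ _ → 1F) ]′
  ⇒part : ∀ u v → u ~ v → part u ≡ part v
  ⇒part (inj₁ _) (inj₁ _) _           = refl
  ⇒part (inj₂ _) (inj₂ _) _           = refl
  ⇒part (inj₁ _) (inj₂ _) (u≢v , u≁v) = contradiction (u≢v , inj₁ tt) u≁v
  ⇒part (inj₂ _) (inj₁ _) (u≢v , u≁v) = contradiction (u≢v , inj₂ tt) u≁v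
  part⇒ : ∀ u v → u ≢ v → part u ≡ part v → u ~ v
  part⇒ (inj₁ _) (inj₁ _) u≢v _ = u≢v , λ { (_ , inj₁ ()) ; (_ , inj₂ ()) }
  part⇒ (inj₂ _) (inj₂ _) u≢v _ = u≢v , λ { (_ , inj₁ ()) ; (_ , inj₂ ()) }

-- The complement consists of a complete graph on the third vertices and two isolated vertices, the
-- ends of the common edge.
complement-B : ∀ p → 𝒦ᵀᴶ (complement (bookGraph p)) ≐ (2 ≤_)
complement-B p = ≐2≤ G {inj₁ 0F} {inj₁ 1F} (λ ())
  (λ (u≢v , u≁v) → u≁v (u≢v , inj₁ tt))
  (cluster-𝒦 (⊎-searchable any? any?) G part (join 2 p) (join-injective 2 p) ⇒part part⇒)
  where
  G : Graph (Fin 2 ⊎ Fin p)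
  G = complement (bookGraph p)
  open Graph G using (_~_)
  part : Fin 2 ⊎ Fin p → Fin 3
  part = [ inject₁ , (λ _ → 2F) ]′
  ⇒part : ∀ u v → u ~ v → part u ≡ part v
  ⇒part (inj₁ _) _        (u≢v , u≁v) = contradiction (u≢v , inj₁ tt) u≁v
  ⇒part (inj₂ _) (inj₁ _) (u≢v , u≁v) = contradiction (u≢v , inj₂ tt) u≁v
  ⇒part (inj₂ _) (inj₂ _) _           = refl
  part⇒ : ∀ u v → u ≢ v → part u ≡ part v → u ~ v
  part⇒ (inj₁ i)  (inj₁ j)  u≢v eq = contradiction (cong inj₁ (inject₁-injective eq)) u≢v
  part⇒ (inj₂ _)  (inj₂ _)  u≢v _  = u≢v , λ { (_ , inj₁ ()) ; (_ , inj₂ ()) }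
  part⇒ (inj₁ 0F) (inj₂ _)  _ ()
  part⇒ (inj₁ 1F) (inj₂ _)  _ ()
  part⇒ (inj₂ _)  (inj₁ 0F) _ ()
  part⇒ (inj₂ _)  (inj₁ 1F) _ ()

-- Complements of paths.

complement-P : ∀ n → 3 ≤ n → n ≤ 5 → 𝒦ᵀᴶ (complement (pathGraph n)) ≐ (2 ≤_)
complement-P 1 (s≤s ()) _
complement-P 2 (s≤s (s≤s ())) _
complement-P 3 _ _ = ≐2≤ G {0F} {1F} (λ ()) (from-no (Graph._~?_ G 0F 1F))
  (rook-𝒦 any? G row id (from-yes (isRookPlacement? any? G row id)))
  where
  G = complement (pathGraph 3)
  row : Fin 3 → Fin 2
  -- In all three cases the rows are the parities. Non-consecutive vertices at odd distance are at
  -- distance 3, as at most five vertices occur; exactly these pairs share a column.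
  row = lookup (0F ∷ 1F ∷ 0F ∷ [])
complement-P 4 _ _ = ≐2≤ G {0F} {1F} (λ ()) (from-no (Graph._~?_ G 0F 1F))
  (rook-𝒦 any? G row column (from-yes (isRookPlacement? any? G row column)))
  where
  G = complement (pathGraph 4)
  row : Fin 4 → Fin 2
  row = lookup (0F ∷ 1F ∷ 0F ∷ 1F ∷ [])
  column : Fin 4 → Fin 3
  column = lookup (0F ∷ 2F ∷ 1F ∷ 0F ∷ [])
complement-P 5 _ _ = ≐2≤ G {0F} {1F} (λ ()) (from-no (Graph._~?_ G 0F 1F))
  (rook-𝒦 any? G row column (from-yes (isRookPlacement? any? G row column)))
  where
  G = complement (pathGraph 5)
  row : Fin 5 → Fin 2
  row = lookup (0F ∷ 1F ∷ 0F ∷ 1F ∷ 0F ∷ [])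
  column : Fin 5 → Fin 3
  column = lookup (0F ∷ 1F ∷ 2F ∷ 0F ∷ 1F ∷ [])
complement-P (suc (suc (suc (suc (suc (suc n)))))) _ (s≤s (s≤s (s≤s (s≤s (s≤s ())))))

-- In the complement, the non-adjacent vertices 0 and 1 have the common neighbours 3, 4, 5, of which
-- 4 is adjacent to neither of the others.
complement-P-∅ : ∀ n → 6 ≤ n → 𝒦ᵀᴶ (complement (pathGraph n)) ≐ ∅
complement-P-∅ (suc (suc (suc (suc (suc (suc n)))))) _ = ≐∅ G λ R → contradiction
  (realised-no-two-non-neighbours R {0F} {1F} {3F} {4F} {5F}
    (λ ()) (from-no (0F ~? 1F)) (λ ()) (from-no (3F ~? 4F)) (λ ()) (from-no (4F ~? 5F))
    (from-yes (0F ~? 3F)) (from-yes (0F ~? 4F)) (from-yes (0F ~? 5F))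
    (from-yes (1F ~? 3F)) (from-yes (1F ~? 4F)) (from-yes (1F ~? 5F))) λ ()
  where
  G = complement (pathGraph (6 + n))
  open Graph G using (_~?_)
complement-P-∅ 1 (s≤s ())
complement-P-∅ 2 (s≤s (s≤s ()))
complement-P-∅ 3 (s≤s (s≤s (s≤s ())))
complement-P-∅ 4 (s≤s (s≤s (s≤s (s≤s ()))))
complement-P-∅ 5 (s≤s (s≤s (s≤s (s≤s (s≤s ())))))


-- Complements of cycles.

complement-C : ∀ n → 4 ≤ n → n ≤ 6 → 𝒦ᵀᴶ (complement (cycleGraph n)) ≐ (2 ≤_)
complement-C 1 (s≤s ()) _
complement-C 2 (s≤s (s≤s ())) _
complement-C 3 (s≤s (s≤s (s≤s ()))) _
complement-C 4 _ _ = ≐2≤ G {0F} {1F} (λ ()) (from-no (Graph._~?_ G 0F 1F))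
  (rook-𝒦 any? G row id (from-yes (isRookPlacement? any? G row id)))
  where
  G = complement (cycleGraph 4)
  row : Fin 4 → Fin 2
  row = lookup (0F ∷ 1F ∷ 0F ∷ 1F ∷ [])
complement-C 5 _ _ = ≐2≤ G {0F} {1F} (λ ()) (from-no (Graph._~?_ G 0F 1F))
  (𝒦-cone (lineGraph-realisation any? e G (from-yes (all? λ v → ∣ e v ∣ ≟ 2)) (from-yes (isLineGraph? any? e G)))
    (triangleFree⇒cliqueFree H (from-yes (triangleFree? H))))
  where
  G = complement (cycleGraph 5)
  e : Fin 5 → Subset 5
  -- The complement is the 5-cycle 0, 2, 4, 1, 3, which no rook placement yields, as its moves would
  -- alternate between rows and columns. It is the line graph of a 5-cycle, whose successive edges
  -- are assigned in this order.
  e = lookup ((⁅ 0F ⁆ ∪ ⁅ 1F ⁆) ∷ (⁅ 3F ⁆ ∪ ⁅ 4F ⁆) ∷ (⁅ 1F ⁆ ∪ ⁅ 2F ⁆) ∷ (⁅ 4F ⁆ ∪ ⁅ 0F ⁆) ∷ (⁅ 2F ⁆ ∪ ⁅ 3F ⁆) ∷ [])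
  H = edgeGraph any? e
complement-C 6 _ _ = ≐2≤ G {0F} {1F} (λ ()) (from-no (Graph._~?_ G 0F 1F))
  (rook-𝒦 any? G row column (from-yes (isRookPlacement? any? G row column)))
  where
  G = complement (cycleGraph 6)
  row : Fin 6 → Fin 2
  -- The complement is a triangular prism: the parity classes are its triangles, and opposite
  -- vertices of the 6-cycle share a column.
  row = lookup (0F ∷ 1F ∷ 0F ∷ 1F ∷ 0F ∷ 1F ∷ [])
  column : Fin 6 → Fin 3
  column = lookup (0F ∷ 1F ∷ 2F ∷ 0F ∷ 1F ∷ 2F ∷ [])
complement-C (suc (suc (suc (suc (suc (suc (suc n))))))) _ (s≤s (s≤s (s≤s (s≤s (s≤s (s≤s ()))))))

-- The witnesses are those for paths. With at least seven vertices, 5 is not the last one and so not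
-- a neighbour of 0 on the cycle.
complement-C-∅ : ∀ n → 7 ≤ n → 𝒦ᵀᴶ (complement (cycleGraph n)) ≐ ∅
complement-C-∅ (suc (suc (suc (suc (suc (suc (suc n))))))) _ = ≐∅ G λ R → contradiction
  (realised-no-two-non-neighbours R {0F} {1F} {3F} {4F} {5F}
    (λ ()) (from-no (0F ~? 1F)) (λ ()) (from-no (3F ~? 4F)) (λ ()) (from-no (4F ~? 5F))
    (from-yes (0F ~? 3F)) (from-yes (0F ~? 4F)) (from-yes (0F ~? 5F))
    (from-yes (1F ~? 3F)) (from-yes (1F ~? 4F)) (from-yes (1F ~? 5F))) λ ()
  where
  G = complement (cycleGraph (7 + n))
  open Graph G using (_~?_)
complement-C-∅ 1 (s≤s ())
complement-C-∅ 2 (s≤s (s≤s ()))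
complement-C-∅ 3 (s≤s (s≤s (s≤s ())))
complement-C-∅ 4 (s≤s (s≤s (s≤s (s≤s ()))))
complement-C-∅ 5 (s≤s (s≤s (s≤s (s≤s (s≤s ())))))
complement-C-∅ 6 (s≤s (s≤s (s≤s (s≤s (s≤s (s≤s ()))))))

-- Complements of friendship graphs.

friendship-searchable : ∀ p → Searchable (⊤ ⊎ (Fin p × Fin 2))
friendship-searchable p = ⊎-searchable ⊤-searchable (×-searchable any? any?)

complement-F₁₂ : ∀ p → p ≡ 1 ⊎ p ≡ 2 → 𝒦ᵀᴶ (complement (friendshipGraph p)) ≐ (2 ≤_)
complement-F₁₂ p (inj₁ refl) = ≐2≤ G {inj₁ tt} {inj₂ (0F , 0F)} (λ ()) (λ (u≢v , u≁v) → u≁v (u≢v , inj₁ tt))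
  (rook-𝒦 (friendship-searchable 1) G place place
    (from-yes (isRookPlacement? (friendship-searchable 1) G place place)))
  where
  G = complement (friendshipGraph 1)
  -- The complement has no edges, so the vertices go on the diagonal.
  place : ⊤ ⊎ (Fin 1 × Fin 2) → Fin 3
  place (inj₁ _)       = 2F
  place (inj₂ (_ , j)) = inject₁ j
complement-F₁₂ p (inj₂ refl) = ≐2≤ G {inj₁ tt} {inj₂ (0F , 0F)} (λ ()) (λ (u≢v , u≁v) → u≁v (u≢v , inj₁ tt))
  (rook-𝒦 (friendship-searchable 2) G row column
    (from-yes (isRookPlacement? (friendship-searchable 2) G row column)))
  where
  G = complement (friendshipGraph 2)
  -- The complement is an isolated vertex and a 4-cycle. The cycle fills a 2 × 2 board, with each
  -- triangle's pair on a diagonal; the common vertex sits apart in a corner.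
  row column : ⊤ ⊎ (Fin 2 × Fin 2) → Fin 3
  row (inj₁ _)        = 2F
  row (inj₂ (_ , j))  = inject₁ j
  column (inj₁ _)         = 2F
  column (inj₂ (0F , j))  = inject₁ j
  column (inj₂ (1F , 0F)) = 1F
  column (inj₂ (1F , 1F)) = 0F

complement-F₃ : 𝒦ᵀᴶ (complement (friendshipGraph 3)) ≐ ｛ 2 ｝
complement-F₃ = to , λ { refl → s≤s z≤n , 6 , edgeGraph (friendship-searchable 3) e , Realisation⇒TJ≅ R₂ }
  where
  G = complement (friendshipGraph 3)
  open Graph G using (_~_; _~?_)
  -- The complement of F₃ is an isolated vertex and an octahedron, the line graph of K₂ ⊔ K₄.
  e : ⊤ ⊎ (Fin 3 × Fin 2) → Subset 6
  e (inj₁ _)         = ⁅ 4F ⁆ ∪ ⁅ 5F ⁆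
  e (inj₂ (0F , 0F)) = ⁅ 0F ⁆ ∪ ⁅ 1F ⁆
  e (inj₂ (0F , 1F)) = ⁅ 2F ⁆ ∪ ⁅ 3F ⁆
  e (inj₂ (1F , 0F)) = ⁅ 0F ⁆ ∪ ⁅ 2F ⁆
  e (inj₂ (1F , 1F)) = ⁅ 1F ⁆ ∪ ⁅ 3F ⁆
  e (inj₂ (2F , 0F)) = ⁅ 0F ⁆ ∪ ⁅ 3F ⁆
  e (inj₂ (2F , 1F)) = ⁅ 1F ⁆ ∪ ⁅ 2F ⁆
  R₂ : Realisation 2 (edgeGraph (friendship-searchable 3) e) G
  R₂ = lineGraph-realisation (friendship-searchable 3) e G
    (from-yes (forall? (friendship-searchable 3) (λ v → ∣ e v ∣ ≟ 2)))
    (from-yes (isLineGraph? (friendship-searchable 3) e G))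

  -- Two faces of the octahedron sharing the edge `b`, `c`, with opposite vertices `a` and `a′`.
  a a′ b c : ⊤ ⊎ (Fin 3 × Fin 2)
  a  = inj₂ (0F , 0F)
  a′ = inj₂ (0F , 1F)
  b  = inj₂ (1F , 0F)
  c  = inj₂ (2F , 0F)

  -- The only common neighbours of `b` and `c` are `a` and `a′`, which are not adjacent.
  no-fourth : ¬ ∃ λ d → (d ~ a ⊎ d ~ a′) × d ~ b × d ~ c
  no-fourth = from-no (friendship-searchable 3 λ d → ((d ~? a) ⊎-dec (d ~? a′)) ×-dec (d ~? b) ×-dec (d ~? c))

  to : ∀ {k} → 𝒦ᵀᴶ G k → 2 ≡ k
  to {k} k∈ with 2 ≟ k
  ... | yes 2≡k = 2≡k
  ... | no  2≢k = contradiction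
    (realised-diamond (TJ≅⇒Realisation (proj₂ (proj₂ (proj₂ k∈))))
      (≤∧≢⇒< (𝒦⇒2≤ G {a} {a′} (λ ()) (from-no (a ~? a′)) k∈) 2≢k) {a} {a′} {b} {c}
      (λ ()) (from-no (a ~? a′)) (from-yes (a ~? b)) (from-yes (a ~? c))
      (from-yes (a′ ~? b)) (from-yes (a′ ~? c)) (from-yes (b ~? c)))
    no-fourth

-- The two outer vertices of one triangle are non-adjacent in the complement, and one outer vertex
-- from each of three other triangles gives a triangle of common neighbours.
complement-F-∅ : ∀ p → 4 ≤ p → 𝒦ᵀᴶ (complement (friendshipGraph p)) ≐ ∅
complement-F-∅ (suc (suc (suc (suc p)))) _ = ≐∅ G λ R →
  realised-no-triangle R {inj₂ (0F , 0F)} {inj₂ (0F , 1F)} {v 1F} {v 2F} {v 3F}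
    (λ ()) (λ (u≢v , u≁v) → u≁v (u≢v , inj₁ refl))
    (across λ ()) (across λ ()) (across λ ()) (across λ ()) (across λ ()) (across λ ())
    (across λ ()) (across λ ()) (across λ ())
  where
  G = complement (friendshipGraph (4 + p))
  open Graph G using (_~_)
  v : Fin (4 + p) → ⊤ ⊎ (Fin (4 + p) × Fin 2)
  v i = inj₂ (i , 0F)
  across : ∀ {i j x y} → i ≢ j → inj₂ (i , x) ~ inj₂ (j , y)
  across i≢j = (λ { refl → i≢j refl }) ,
    λ { (_ , inj₁ i≡j) → i≢j i≡j ; (_ , inj₂ j≡i) → i≢j (sym j≡i) }
complement-F-∅ 1 (s≤s ())
complement-F-∅ 2 (s≤s (s≤s ()))
complement-F-∅ 3 (s≤s (s≤s (s≤s ())))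

theorem4p10 : (∀ n → 2 ≤ n → 𝒦ᵀᴶ (complement (completeGraph n)) ≐ (2 ≤_))
    × (∀ n → 1 ≤ n → 𝒦ᵀᴶ (complement (completeBipartite 1 n)) ≐ (2 ≤_))
    × (∀ m n → 2 ≤ m → m ≤ n → 𝒦ᵀᴶ (complement (completeBipartite m n)) ≐ (2 ≤_))
    × (∀ p → 1 ≤ p → 𝒦ᵀᴶ (complement (bookGraph p)) ≐ (2 ≤_))
    × ((∀ n → 3 ≤ n → n ≤ 5 → 𝒦ᵀᴶ (complement (pathGraph n)) ≐ (2 ≤_))
    × (∀ n → 6 ≤ n → 𝒦ᵀᴶ (complement (pathGraph n)) ≐ ∅))
    × ((∀ n → 4 ≤ n → n ≤ 6 → 𝒦ᵀᴶ (complement (cycleGraph n)) ≐ (2 ≤_))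
    × (∀ n → 7 ≤ n → 𝒦ᵀᴶ (complement (cycleGraph n)) ≐ ∅))
    × ((∀ p → p ≡ 1 ⊎ p ≡ 2 → 𝒦ᵀᴶ (complement (friendshipGraph p)) ≐ (2 ≤_))
    × (𝒦ᵀᴶ (complement (friendshipGraph 3)) ≐ ｛ 2 ｝)
    × (∀ p → 4 ≤ p → 𝒦ᵀᴶ (complement (friendshipGraph p)) ≐ ∅))
theorem4p10 =
    complement-K
  , (λ n 1≤n → complement-K[ 1 , n ] ≤-refl 1≤n)
  , (λ m n 2≤m m≤n → complement-K[ m , n ] (<⇒≤ 2≤m) (≤-trans (<⇒≤ 2≤m) m≤n))
  , (λ p _ → complement-B p)
  , (complement-P , complement-P-∅)
  , (complement-C , complement-C-∅)
  , (complement-F₁₂ , complement-F₃ , complement-F-∅)
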